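{- There is a single-valued $\mathsf{FS_2P}$ algorithm $A$: for every $n$ and every circuit $C:\{0,1\}^n\to\{0,1\}^{2n}$ given as input, $A(C)$ outputs some $y_C\in\{0,1\}^{2n}$ with $y_C\notin\mathrm{Im}(C)$.
   Context: A single-valued $\mathsf{FS_2P}$ algorithm $A$ is specified by a polynomial $\ell(\cdot)$ and a deterministic polynomial-time algorithm $V_A(x,\pi_1,\pi_2)$. On input $x$, $A$ outputs $y_x$ if (1) there is $\pi_1\in\{0,1\}^{\ell(|x|)}$ such that for every $\pi_2\in\{0,1\}^{\ell(|x|)}$, $V_A(x,\pi_1,\pi_2)=y_x$, and (2) there is $\pi_2\in\{0,1\}^{\ell(|x|)}$ such that for every $\pi_1\in\{0,1\}^{\ell(|x|)}$, $V_A(x,\pi_1,\pi_2)=y_x$. -}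

module Defs where

open import Data.Bool using (Bool; true; false; _∧_; _∨_; not)
open import Data.Fin using (Fin; toℕ)
open import Data.List using (List; []; _∷_; _++_; map; length; replicate)
open import Data.Maybe using (Maybe; just; nothing)
import Data.Maybe as Maybe
open import Data.Nat using (ℕ; suc; _+_; _*_; _≤_)
open import Data.Product using (Σ; ∃-syntax; _×_; _,_)
open import Data.Vec using (Vec; []; _∷_; lookup; toList; head; drop; sum)
import Data.Vec as Vec
open import Function.Bundles using (_↔_)
open import Relation.Binary.PropositionalEquality using (_≡_; sym; trans)

BitString : Set
BitString = List Bool

-- Polynomials over ℕ as coefficient lists, constant term first.
Polynomial : Set
Polynomial = List ℕ

⟦_⟧ : Polynomial → ℕ → ℕ
⟦ []    ⟧ n = 0
⟦ a ∷ p ⟧ n = a + n * ⟦ p ⟧ n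

data Symbol (a : ℕ) : Set where
  □    : Symbol a
  bit  : Bool → Symbol a
  work : Fin a → Symbol a

data Move : Set where
  L R S : Move

-- A two-way infinite tape: `left` lists the cells to the left of the
-- scanned cell, nearest first; all cells not listed are blank.
record Tape (a : ℕ) : Set where
  constructor tape
  field
    left    : List (Symbol a)
    scanned : Symbol a
    right   : List (Symbol a)

write : ∀ {a} → Symbol a → Tape a → Tape a
write s (tape l _ r) = tape l s r

move : ∀ {a} → Move → Tape a → Tape a
move L (tape []      s r)       = tape [] □ (s ∷ r)
move L (tape (x ∷ l) s r)       = tape l x (s ∷ r)
move R (tape l       s [])      = tape (s ∷ l) □ []
move R (tape l       s (x ∷ r)) = tape (s ∷ l) x r
move S t                        = t

-- A deterministic machine with `arity` input tapes, followed by one output tape and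
-- `extra` further work tapes.  All tapes are readable and writable.
-- The transition function is `nothing` exactly where the machine halts.
record TM (arity : ℕ) : Set₁ where
  field
    extra    : ℕ
    alphabet : ℕ
    State    : Set
    #states  : ℕ
    finite   : State ↔ Fin #states
    start    : State

  tapes : ℕ
  tapes = arity + suc extra

  field
    δ : State → Vec (Symbol alphabet) tapes →
        Maybe (State × Vec (Symbol alphabet × Move) tapes)

module _ {arity : ℕ} (M : TM arity) where
  open TM M

  Config : Set
  Config = State × Vec (Tape alphabet) tapes

  act : Symbol alphabet × Move → Tape alphabet → Tape alphabet
  act (s , m) t = move m (write s t)

  step : Config → Maybe Config
  step (q , ts) =
    Maybe.map (λ { (q′ , as) → q′ , Vec.zipWith act as ts })
              (δ q (Vec.map Tape.scanned ts))

  -- HaltsIn t c c′ : started in c, the machine halts in c′ after exactly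
  -- t steps.
  data HaltsIn : ℕ → Config → Config → Set where
    halt : ∀ {c} → step c ≡ nothing → HaltsIn 0 c c
    next : ∀ {t c c′ c″} → step c ≡ just c′ → HaltsIn t c′ c″ →
           HaltsIn (suc t) c c″

  -- The head starts on the first bit of the input.
  inputTape : BitString → Tape alphabet
  inputTape []      = tape [] □ []
  inputTape (b ∷ w) = tape [] (bit b) (map bit w)

  initial : Vec BitString arity → Config
  initial ws =
    start , Vec.map inputTape ws Vec.++ Vec.replicate (suc extra) (tape [] □ [])

  leadingBits : List (Symbol alphabet) → BitString
  leadingBits (bit b ∷ ss) = b ∷ leadingBits ss
  leadingBits _            = []

  -- The output is the maximal block of bits on the output tape that starts
  -- at the head and extends to the right.
  output : Config → BitString
  output (_ , ts) = leadingBits (Tape.scanned out ∷ Tape.right out)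
    where out = head (drop arity ts)

totalLength : ∀ {m} → Vec BitString m → ℕ
totalLength ws = sum (Vec.map length ws)

ComputesInTime : ∀ {m} → TM m → Polynomial → (Vec BitString m → BitString) → Set
ComputesInTime M p f = ∀ ws →
  ∃[ t ] ∃[ c ] t ≤ ⟦ p ⟧ (totalLength ws)
              × HaltsIn M t (initial M ws) c
              × output M c ≡ f ws

PolyTime : ∀ {m} → (Vec BitString m → BitString) → Set₁
PolyTime {m} f = Σ (TM m) λ M → ∃[ p ] ComputesInTime M p f

record FS₂P-Algorithm : Set₁ where
  field
    ℓ          : Polynomial
    V          : Vec BitString 3 → BitString
    V-polyTime : PolyTime V

  Proof : BitString → Set
  Proof x = Vec Bool (⟦ ℓ ⟧ (length x))

  verify : (x : BitString) (π₁ π₂ : Proof x) → BitString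
  verify x π₁ π₂ = V (x ∷ toList π₁ ∷ toList π₂ ∷ [])

  Outputs : (x y : BitString) → Set
  Outputs x y = (∃[ π₁ ] ∀ π₂ → verify x π₁ π₂ ≡ y)
              × (∃[ π₂ ] ∀ π₁ → verify x π₁ π₂ ≡ y)

  Outputs-unique : ∀ {x y y′} → Outputs x y → Outputs x y′ → y ≡ y′
  Outputs-unique ((π₁ , p) , _) (_ , (π₂ , q)) = trans (sym (p π₂)) (q π₁)

-- A circuit is a straight-line program.  Wires are addressed by de Bruijn
-- indices: each gate puts its value on a new wire with index zero and
-- shifts the indices of all earlier wires by one.
data Gate (w : ℕ) : Set where
  and or : Fin w → Fin w → Gate w
  neg    : Fin w → Gate w

infixr 5 _∷_

data Gates : ℕ → ℕ → Set where
  []  : ∀ {w} → Gates w w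
  _∷_ : ∀ {w w′} → Gate w → Gates (suc w) w′ → Gates w w′

record Circuit (n m : ℕ) : Set where
  constructor circuit
  field
    {wires} : ℕ
    gates   : Gates n wires
    outputs : Vec (Fin wires) m

evalGate : ∀ {w} → Gate w → Vec Bool w → Bool
evalGate (and i j) v = lookup v i ∧ lookup v j
evalGate (or i j)  v = lookup v i ∨ lookup v j
evalGate (neg i)   v = not (lookup v i)

evalGates : ∀ {w w′} → Gates w w′ → Vec Bool w → Vec Bool w′
evalGates []       v = v
evalGates (g ∷ gs) v = evalGates gs (evalGate g v ∷ v)

eval : ∀ {n m} → Circuit n m → Vec Bool n → Vec Bool m
eval (circuit gs os) x = Vec.map (lookup (evalGates gs x)) os

_∈Im_ : ∀ {n m} → Vec Bool m → Circuit n m → Set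
y ∈Im C = ∃[ x ] eval C x ≡ y

-- Numbers are written in unary.  As every gate and every output is listed
-- explicitly, the length of `encode C` is at most quadratic in the number of
-- inputs, gates and outputs of C, hence polynomially related to the length
-- of an encoding with binary wire indices.
unary : ℕ → BitString
unary k = replicate k true ++ false ∷ []

encodeWire : ∀ {w} → Fin w → BitString
encodeWire i = unary (toℕ i)

encodeGate : ∀ {w} → Gate w → BitString
encodeGate (and i j) = false ∷ false ∷ encodeWire i ++ encodeWire j
encodeGate (or i j)  = false ∷ true  ∷ encodeWire i ++ encodeWire j
encodeGate (neg i)   = true  ∷ false ∷ encodeWire i

encodeGates : ∀ {w w′} → Gates w w′ → BitString
encodeGates []       = true ∷ true ∷ []
encodeGates (g ∷ gs) = encodeGate g ++ encodeGates gs

encodeOutputs : ∀ {w m} → Vec (Fin w) m → BitString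
encodeOutputs []       = []
encodeOutputs (o ∷ os) = encodeWire o ++ encodeOutputs os

encode : ∀ {n m} → Circuit n m → BitString
encode {n} {m} (circuit gs os) =
  unary n ++ unary m ++ encodeGates gs ++ encodeOutputs os

{-# OPTIONS --safe #-}

-- Consider the complete binary tree of depth 2n whose leaves carry all strings of length
-- 2n.  In postorder, give every node the least preimage under C of the string at the leaf,
-- or of the concatenation of its children's values.  As C is not onto, this gets stuck at
-- a node whose string y has no preimage.  The values given before are determined by those
-- at the roots of the O(n) maximal finished subtrees, since C recovers the values below
-- them: this is the proof of y.  Of two different proofs one can find the wrong one by
-- following the leftmost disagreement from the root downwards.  At the last node where
-- the proofs differ, a finished node beats a stuck one with the same string, the smaller
-- of two preimages of the same string beats the larger, and a wrong leaf loses.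
--
-- Polynomial running time comes for free by writing the verifier in a language of stack
-- programs whose only loop repeats its body a fixed number of times.

module Submission where

open import Algebra.Properties.CommutativeSemigroup using (interchange)
open import Data.Bool using (Bool; true; false; if_then_else_; _∧_; _∨_; not)
import Data.Bool.Properties as Boolₚ
open import Data.Empty using (⊥-elim)
open import Data.Fin using (Fin; zero; suc; toℕ; fromℕ<; splitAt; join; _↑ˡ_; _↑ʳ_; combine; remQuot)
open import Data.Fin.Patterns
import Data.Fin.Properties as Finₚ
open import Data.List using (List; []; _∷_; _++_; map; length; replicate; drop; take; _ʳ++_)
open import Data.List.Properties
  using (length-map; length-replicate; map-ʳ++; ʳ++-ʳ++; ++-ʳ++; length-ʳ++; length-++; ++-identityʳ; ++-assoc;
         ∷-injectiveˡ; ∷-injectiveʳ)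
import Data.List.Properties as Listₚ
open import Data.Maybe using (Maybe; just; nothing; maybe)
import Data.Maybe as Maybe
open import Data.Nat using (ℕ; zero; suc; _+_; _*_; _∸_; _^_; _⊔_; _≤_; _<_; z≤n; s≤s; NonZero)
open import Data.Nat.Properties
open import Data.Product using (Σ; ∃-syntax; _×_; _,_; proj₁; proj₂; uncurry)
open import Data.Product.Properties using () renaming (≡-dec to ×-≡-dec)
open import Data.Sum using (_⊎_; inj₁; inj₂)
open import Data.Sum.Function.Propositional using (_⊎-↔_)
open import Data.Sum.Properties using (inj₁-injective; inj₂-injective) renaming (≡-dec to ⊎-≡-dec)
open import Data.Unit using (⊤; tt)
open import Data.Vec using (Vec; []; _∷_; lookup; tabulate; toList; _[_]%=_; _[_]≔_)
import Data.Vec as Vec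
open import Data.Vec.Properties
  using (lookup∘tabulate; lookup-map; lookup-zipWith; lookup-replicate; lookup∘updateAt; lookup∘updateAt′;
         lookup∘update; lookup∘update′; updateAt-commutes; updateAt-updateAt; []≔-lookup)
import Data.Vec.Properties as Vecₚ
open import Function using (_∘_)
open import Function.Bundles using (_↔_; mk↔ₛ′; Inverse)
open import Function.Properties.Inverse using (↔-sym; ↔-trans)
open import Relation.Binary.PropositionalEquality
  using (_≡_; _≢_; refl; sym; trans; cong; cong₂; subst)
open import Relation.Nullary using (¬_; Dec; yes; no; does)
open import Relation.Nullary.Decidable using (True; toWitness; dec-true; dec-false; _→-dec_)
open import Defs

-- Structured control for multitape machines

-- A history cannot be checked on its own, as its finished subtrees may be exponentially large. It
-- suffices that a correct history never loses to one with a different answer. This is a local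
-- matter, because a value of `n` bits determines the values of both children. If two finished nodes
-- on the walk hold different values, then either their images differ, and the disagreement passes
-- to a child, or both are preimages of one string, and minimality decides. At a leaf the block is
-- compared with the path, so a disagreement cannot run out undecided. A verdict given on the way
-- may therefore be wrong as long as a later one overrules it, and only the last counts. A correct
-- history may even be ruled against, since the filler bits of unfinished nodes are compared as
-- well, but then both histories give the same answer.

Sym : Set
Sym = Symbol 0

data Cmd (I : Set) : Set where
  basic  : (I → Sym → Sym × Move) → Cmd I
  _▸_    : Cmd I → Cmd I → Cmd I
  branch : I → (Sym → Bool) → Cmd I → Cmd I → Cmd I
  while  : I → (Sym → Bool) → Cmd I → Cmd I

infixr 4 _▸_

-- These are the control states: one for each basic action and each test. Sequencing adds none,
-- since leaving `c` in `c ▸ d` enters `d` within the same step.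
Pos : ∀ {I} → Cmd I → Set
Pos (basic _)        = ⊤
Pos (c ▸ d)          = Pos c ⊎ Pos d
Pos (branch _ _ c d) = ⊤ ⊎ (Pos c ⊎ Pos d)
Pos (while _ _ c)    = ⊤ ⊎ Pos c

entry : ∀ {I} (c : Cmd I) → Pos c
entry (basic _)        = tt
entry (c ▸ _)          = inj₁ (entry c)
entry (branch _ _ _ _) = inj₁ tt
entry (while _ _ _)    = inj₁ tt

thenEnter : ∀ {A B : Set} → (A → B) → B → Maybe A → Maybe B
thenEnter f b = maybe (just ∘ f) (just b)

-- `nothing` means that control leaves the command.
goto : ∀ {I} (c : Cmd I) → Pos c → (I → Sym) → Maybe (Pos c)
goto (basic _) _ ss = nothing
goto (c ▸ d) (inj₁ p) ss = thenEnter inj₁ (inj₂ (entry d)) (goto c p ss)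
goto (c ▸ d) (inj₂ p) ss = Maybe.map inj₂ (goto d p ss)
goto (branch i t c d) (inj₁ _) ss =
  just (inj₂ (if t (ss i) then inj₁ (entry c) else inj₂ (entry d)))
goto (branch i t c d) (inj₂ (inj₁ p)) ss = Maybe.map (inj₂ ∘ inj₁) (goto c p ss)
goto (branch i t c d) (inj₂ (inj₂ p)) ss = Maybe.map (inj₂ ∘ inj₂) (goto d p ss)
goto (while i t c) (inj₁ _) ss = if t (ss i) then just (inj₂ (entry c)) else nothing
goto (while i t c) (inj₂ p) ss = thenEnter inj₂ (inj₁ tt) (goto c p ss)

acts : ∀ {I} (c : Cmd I) → Pos c → (I → Sym) → I → Sym × Move
acts (basic f) _ ss i = f i (ss i)
acts (c ▸ d) (inj₁ p) = acts c p
acts (c ▸ d) (inj₂ p) = acts d p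
acts (branch _ _ c d) (inj₁ _) ss i = ss i , S
acts (branch _ _ c d) (inj₂ (inj₁ p)) = acts c p
acts (branch _ _ c d) (inj₂ (inj₂ p)) = acts d p
acts (while _ _ c) (inj₁ _) ss i = ss i , S
acts (while _ _ c) (inj₂ p) = acts c p

-- The machine reads symbols out of a vector, `Run` out of a function. The two agree only pointwise,
-- and without function extensionality this congruence has to be proved by hand.
goto-cong : ∀ {I} (c : Cmd I) p {ss ss′ : I → Sym} → (∀ i → ss i ≡ ss′ i) → goto c p ss ≡ goto c p ss′
goto-cong (basic _) _ e = refl
goto-cong (c ▸ d) (inj₁ p) e = cong (thenEnter inj₁ _) (goto-cong c p e)
goto-cong (c ▸ d) (inj₂ p) e = cong (Maybe.map inj₂) (goto-cong d p e)
goto-cong (branch i t c d) (inj₁ _) e rewrite e i = refl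
goto-cong (branch i t c d) (inj₂ (inj₁ p)) e = cong (Maybe.map _) (goto-cong c p e)
goto-cong (branch i t c d) (inj₂ (inj₂ p)) e = cong (Maybe.map _) (goto-cong d p e)
goto-cong (while i t c) (inj₁ _) e rewrite e i = refl
goto-cong (while i t c) (inj₂ p) e = cong (thenEnter inj₂ _) (goto-cong c p e)

acts-cong : ∀ {I} (c : Cmd I) p {ss ss′ : I → Sym} → (∀ i → ss i ≡ ss′ i) →
            ∀ i → acts c p ss i ≡ acts c p ss′ i
acts-cong (basic f) _ e i = cong (f i) (e i)
acts-cong (c ▸ d) (inj₁ p) e = acts-cong c p e
acts-cong (c ▸ d) (inj₂ p) e = acts-cong d p e
acts-cong (branch _ _ c d) (inj₁ _) e i = cong (_, S) (e i)
acts-cong (branch _ _ c d) (inj₂ (inj₁ p)) e = acts-cong c p e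
acts-cong (branch _ _ c d) (inj₂ (inj₂ p)) e = acts-cong d p e
acts-cong (while _ _ c) (inj₁ _) e i = cong (_, S) (e i)
acts-cong (while _ _ c) (inj₂ p) e = acts-cong c p e

Tapes : Set → Set
Tapes I = I → Tape 0

scan : ∀ {I} → Tapes I → I → Sym
scan g i = Tape.scanned (g i)

perform : Sym × Move → Tape 0 → Tape 0
perform (s , m) t = move m (write s t)

-- The next position in `tick` is computed by `goto`, so in the composition lemmas every `tick` of a
-- part is, by computation, a `tick` of the whole command.
data Run {I : Set} (c : Cmd I) : Maybe (Pos c) → Tapes I → ℕ → Tapes I → Set where
  exit : ∀ {g} → Run c nothing g 0 g
  tick : ∀ {p g t g′} →
         Run c (goto c p (scan g)) (λ i → perform (acts c p (scan g) i) (g i)) t g′ →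
         Run c (just p) g (suc t) g′

Exec : ∀ {I} → Cmd I → Tapes I → ℕ → Tapes I → Set
Exec c = Run c (just (entry c))

module _ {I : Set} where

  run-seqʳ : ∀ {c d : Cmd I} {q g t g′} → Run d q g t g′ → Run (c ▸ d) (Maybe.map inj₂ q) g t g′
  run-seqʳ exit     = exit
  run-seqʳ (tick r) = tick (run-seqʳ r)

  run-seq : ∀ {c d : Cmd I} {q g t g′ u g″} → Run c q g t g′ → Exec d g′ u g″ →
            Run (c ▸ d) (thenEnter inj₁ (inj₂ (entry d)) q) g (t + u) g″
  run-seq exit     s = run-seqʳ s
  run-seq (tick r) s = tick (run-seq r s)

  run-branchˡ : ∀ {i t} {c d : Cmd I} {q g u g′} → Run c q g u g′ →
                Run (branch i t c d) (Maybe.map (inj₂ ∘ inj₁) q) g u g′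
  run-branchˡ exit     = exit
  run-branchˡ (tick r) = tick (run-branchˡ r)

  run-branchʳ : ∀ {i t} {c d : Cmd I} {q g u g′} → Run d q g u g′ →
                Run (branch i t c d) (Maybe.map (inj₂ ∘ inj₂) q) g u g′
  run-branchʳ exit     = exit
  run-branchʳ (tick r) = tick (run-branchʳ r)

  run-body : ∀ {i t} {c : Cmd I} {q g u g′ v g″} → Run c q g u g′ → Exec (while i t c) g′ v g″ →
             Run (while i t c) (thenEnter inj₂ (inj₁ tt) q) g (u + v) g″
  run-body exit     s = s
  run-body (tick r) s = tick (run-body r s)

  exec-basic : ∀ {f : I → Sym → Sym × Move} {g} →
             Exec (basic f) g 1 (λ i → perform (f i (scan g i)) (g i))
  exec-basic = tick exit

  exec-seq : ∀ {c d : Cmd I} {g t g′ u g″} → Exec c g t g′ → Exec d g′ u g″ → Exec (c ▸ d) g (t + u) g″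
  exec-seq = run-seq

  exec-true : ∀ {i t} {c d : Cmd I} {g u g′} → t (scan g i) ≡ true → Exec c g u g′ →
              Exec (branch i t c d) g (suc u) g′
  exec-true {i} {t} {c} {d} {g} {u} {g′} e r =
    tick (subst (λ b → Run (branch i t c d)
                         (just (inj₂ (if b then inj₁ (entry c) else inj₂ (entry d)))) g u g′)
                (sym e) (run-branchˡ r))

  exec-false : ∀ {i t} {c d : Cmd I} {g u g′} → t (scan g i) ≡ false → Exec d g u g′ →
               Exec (branch i t c d) g (suc u) g′
  exec-false {i} {t} {c} {d} {g} {u} {g′} e r =
    tick (subst (λ b → Run (branch i t c d)
                         (just (inj₂ (if b then inj₁ (entry c) else inj₂ (entry d)))) g u g′)
                (sym e) (run-branchʳ r))

  exec-stop : ∀ {i t} {c : Cmd I} {g} → t (scan g i) ≡ false → Exec (while i t c) g 1 g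
  exec-stop {i} {t} {c} {g} e =
    tick (subst (λ b → Run (while i t c) (if b then just (inj₂ (entry c)) else nothing) g 0 g)
                (sym e) exit)

  exec-loop : ∀ {i t} {c : Cmd I} {g u g′ v g″} → t (scan g i) ≡ true → Exec c g u g′ →
              Exec (while i t c) g′ v g″ → Exec (while i t c) g (suc (u + v)) g″
  exec-loop {i} {t} {c} {g} {u} {g′} {v} {g″} e r s =
    tick (subst (λ b → Run (while i t c) (if b then just (inj₂ (entry c)) else nothing) g (u + v) g″)
                (sym e) (run-body r s))

size : ∀ {I} → Cmd I → ℕ
size (basic _)        = 1
size (c ▸ d)          = size c + size d
size (branch _ _ c d) = 1 + (size c + size d)
size (while _ _ c)    = 1 + size c

⊎-finite : ∀ {A B : Set} {m n} → A ↔ Fin m → B ↔ Fin n → (A ⊎ B) ↔ Fin (m + n)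
⊎-finite f g = ↔-trans (f ⊎-↔ g) (↔-sym Finₚ.+↔⊎)

pos-finite : ∀ {I} (c : Cmd I) → Pos c ↔ Fin (size c)
pos-finite (basic _)        = ↔-sym Finₚ.1↔⊤
pos-finite (c ▸ d)          = ⊎-finite (pos-finite c) (pos-finite d)
pos-finite (branch _ _ c d) = ⊎-finite (↔-sym Finₚ.1↔⊤) (⊎-finite (pos-finite c) (pos-finite d))
pos-finite (while _ _ c)    = ⊎-finite (↔-sym Finₚ.1↔⊤) (pos-finite c)

maybe-finite : ∀ {A : Set} {n} → A ↔ Fin n → Maybe A ↔ Fin (suc n)
maybe-finite f = mk↔ₛ′ (maybe (suc ∘ to) zero)
                       (λ { zero → nothing ; (suc i) → just (from i) })
                       (λ { zero → refl ; (suc i) → cong suc (strictlyInverseˡ i) })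
                       (λ { nothing → refl ; (just a) → cong just (strictlyInverseʳ a) })
  where open Inverse f

-- The first 4 + k tapes hold data, the remaining D ones clocks.
module _ {k D : ℕ} where

  private
    K I′ : Set
    K  = Fin (4 + k)
    I′ = K ⊎ Fin D

  machine : Cmd I′ → TM 3
  machine c = record
    -- `3 + suc (k + D)` computes to `4 + k + D`: three inputs, the output, `k` further stacks and
    -- `D` clocks.
    { extra    = k + D
    ; alphabet = 0
    ; State    = Maybe (Pos c)
    ; #states  = suc (size c)
    ; finite   = maybe-finite (pos-finite c)
    ; start    = just (entry c)
    ; δ        = λ
      { nothing  _  → nothing
      ; (just p) ss →
          let ss′ = λ i → lookup ss (join (4 + k) D i)
          in just (goto c p ss′ , tabulate (λ i → acts c p ss′ (splitAt (4 + k) i)))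
      }
    }

  Shows : Vec (Tape 0) (4 + k + D) → Tapes I′ → Set
  Shows ts g = ∀ i → lookup ts (join (4 + k) D i) ≡ g i

  simulate : ∀ (c : Cmd I′) {q g t g′} → Run c q g t g′ → ∀ ts → Shows ts g →
             ∃[ ts′ ] HaltsIn (machine c) t (q , ts) (nothing , ts′) × Shows ts′ g′
  simulate c exit ts s = ts , halt refl , s
  simulate c {g = g} (tick {p} {t = t} r) ts s =
    let ss    = λ i → lookup (Vec.map Tape.scanned ts) (join (4 + k) D i)
        as    = tabulate (λ i → acts c p ss (splitAt (4 + k) i))
        e : ∀ i → ss i ≡ scan g i
        e i   = trans (lookup-map (join (4 + k) D i) Tape.scanned ts) (cong Tape.scanned (s i))
        ts′   = Vec.zipWith (act′ c) as ts
        s′ : Shows ts′ (λ i → perform (acts c p (scan g) i) (g i))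
        s′ i  = trans (lookup-zipWith (act′ c) (join (4 + k) D i) as ts)
                  (cong₂ perform
                    (trans (lookup∘tabulate (λ i → acts c p ss (splitAt (4 + k) i)) (join (4 + k) D i))
                      (trans (cong (acts c p ss) (Finₚ.splitAt-join (4 + k) D i))
                             (acts-cong c p e i)))
                    (s i))
        ts″ , h , s″ = simulate c r ts′ s′
    in ts″
     , next refl (subst (λ q → HaltsIn (machine c) t (q , ts′) (nothing , ts″)) (sym (goto-cong c p e)) h)
     , s″
    where
    act′ : ∀ c → _
    act′ c = act (machine c)

-- Tapes up to blanks

data _⊑_ : List Sym → List Sym → Set where
  []  : [] ⊑ []
  □∷_ : ∀ {ys} → [] ⊑ ys → [] ⊑ (□ ∷ ys)
  keep : ∀ {x xs ys} → xs ⊑ ys → (x ∷ xs) ⊑ (x ∷ ys)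

infix 4 _⊑_ _~_

-- The scanned cell counts as part of the right half. A stack `w` is a tape `~ ([] , map bit w)`:
-- its top is scanned, and the empty stack is a head among blanks.
record _~_ (t : Tape 0) (a : List Sym × List Sym) : Set where
  constructor _,_
  field
    leftward  : proj₁ a ⊑ Tape.left t
    rightward : proj₂ a ⊑ Tape.scanned t ∷ Tape.right t

scanned-[] : ∀ {t l} → t ~ (l , []) → Tape.scanned t ≡ □
scanned-[] (_ , (□∷ _)) = refl

scanned-∷ : ∀ {t l x r} → t ~ (l , x ∷ r) → Tape.scanned t ≡ x
scanned-∷ (_ , (keep _)) = refl

~moveR : ∀ {t l x r} → t ~ (l , x ∷ r) → move R t ~ (x ∷ l , r)
~moveR {tape _ _ []}      (p , (keep [])) = (keep p) , (□∷ [])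
~moveR {tape _ _ (_ ∷ _)} (p , (keep q))  = (keep p) , q

~moveL : ∀ {t l x r} → t ~ (x ∷ l , r) → move L t ~ (l , x ∷ r)
~moveL ((keep p) , q) = p , (keep q)

~moveL-edge : ∀ {t r} → t ~ ([] , r) → move L t ~ ([] , □ ∷ r)
~moveL-edge ([] , q)     = [] , (keep q)
~moveL-edge ((□∷ p) , q) = p , (keep q)

~moveR-edge : ∀ {t r} → t ~ ([] , □ ∷ r) → move R t ~ ([] , r)
~moveR-edge {tape _ _ []}      (p , (keep [])) = (□∷ p) , (□∷ [])
~moveR-edge {tape _ _ (_ ∷ _)} (p , (keep q))  = (□∷ p) , q

-- Popping an empty stack also moves the head. This is invisible, because only blanks are left
-- behind.
~erase : ∀ {t r} → t ~ ([] , r) → move R (write □ t) ~ ([] , drop 1 r)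
~erase {tape _ _ []}      (p , (□∷ [])) = (□∷ p) , (□∷ [])
~erase {tape _ _ (_ ∷ _)} (p , (□∷ q))  = (□∷ p) , q
~erase {tape _ _ []}      (p , (keep []))  = (□∷ p) , (□∷ [])
~erase {tape _ _ (_ ∷ _)} (p , (keep q))   = (□∷ p) , q

~write : ∀ {t l x r} y → t ~ (l , x ∷ r) → write y t ~ (l , y ∷ r)
~write _ (p , (keep q)) = p , (keep q)

isBit : Sym → Bool
isBit (bit _) = true
isBit _       = false

isTrue : Sym → Bool
isTrue (bit b) = b
isTrue _       = false

module _ {I : Set} where

  onlyAt : (I → Bool) → (Sym → Sym × Move) → Cmd I
  onlyAt P a = basic (λ j s → if P j then a s else (s , S))

  private
    step-at : (I → Bool) → (Sym → Sym × Move) → Tapes I → Tapes I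
    step-at P a g j = perform (if P j then a (scan g j) else (scan g j , S)) (g j)

    at-true : ∀ P a g {j} → P j ≡ true → step-at P a g j ≡ perform (a (scan g j)) (g j)
    at-true P a g e rewrite e = refl

    at-false : ∀ P a g {j} → P j ≡ false → step-at P a g j ≡ g j
    at-false P a g e rewrite e = refl

  exec-onlyAt : ∀ P a (g : Tapes I) → ∃[ g′ ] Exec (onlyAt P a) g 1 g′
                × (∀ j → P j ≡ true → g′ j ≡ perform (a (scan g j)) (g j))
                × (∀ j → P j ≡ false → g′ j ≡ g j)
  exec-onlyAt P a g = _ , exec-basic , (λ _ → at-true P a g) , (λ _ → at-false P a g)

  leftAt rightAt : (I → Bool) → Cmd I
  leftAt  P = onlyAt P (_, L)
  rightAt P = onlyAt P (_, R)

  -- All tapes in `P` move in lockstep and tape `i` alone decides when to stop. The heads overshoot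
  -- to the blank before the contents and then step back.
  rewind : (I → Bool) → I → Cmd I
  rewind P i = leftAt P ▸ while i isBit (leftAt P) ▸ rightAt P

  private
    shift-ʳ++ : ∀ (l r : List Sym) → drop 1 l ʳ++ (take 1 l ++ r) ≡ l ʳ++ r
    shift-ʳ++ []      r = refl
    shift-ʳ++ (_ ∷ _) r = refl

    ~shift : ∀ {t l r n} → length l ≡ suc n → t ~ (l , r) → move L t ~ (drop 1 l , take 1 l ++ r)
    ~shift {l = _ ∷ _} _ p = ~moveL p

    length-shift : ∀ (l : List Sym) {n} → length l ≡ suc n → length (drop 1 l) ≡ n
    length-shift (_ ∷ _) refl = refl

    At : (I → Bool) → ℕ → (l r : I → List Sym) → Tapes I → Set
    At P n l r g = ∀ j → P j ≡ true → length (l j) ≡ n × g j ~ (l j , r j)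

    -- The contents `l j ʳ++ r j` are invariant while cells pass from `l j` to `r j`. The first move
    -- is kept apart from the loop because it precedes the first test.
    back : ∀ P i n (g : Tapes I) l r w → P i ≡ true → At P n l r g → l i ≡ map bit w →
           ∃[ g₁ ] ∃[ g₂ ] Exec (leftAt P) g 1 g₁ × Exec (while i isBit (leftAt P)) g₁ (1 + n * 2) g₂
           × (∀ j → P j ≡ true → g₂ j ~ ([] , □ ∷ l j ʳ++ r j))
           × (∀ j → P j ≡ false → g₂ j ≡ g j)
    back P i zero g l r w Pi at li with exec-onlyAt P (_, L) g
    ... | g₁ , x , on , off = g₁ , g₁ , x , exec-stop (cong isBit (scanned-∷ (new i Pi))) , new , off
      where
      new : ∀ j → P j ≡ true → g₁ j ~ ([] , □ ∷ l j ʳ++ r j)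
      new j Pj with l j | at j Pj
      ... | [] | _ , p = subst (_~ ([] , □ ∷ r j)) (sym (on j Pj)) (~moveL-edge p)
    back P i (suc n) g l r [] Pi at li with trans (sym (proj₁ (at i Pi))) (cong length li)
    ... | ()
    back P i (suc n) g l r (b ∷ w) Pi at li with exec-onlyAt P (_, L) g
    ... | g₁ , x , on , off
      with back P i n g₁ (λ j → drop 1 (l j)) (λ j → take 1 (l j) ++ r j) w Pi
             (λ j Pj → length-shift (l j) (proj₁ (at j Pj)) ,
               subst (_~ (drop 1 (l j) , take 1 (l j) ++ r j)) (sym (on j Pj))
                 (~shift (proj₁ (at j Pj)) (proj₂ (at j Pj))))
             (cong (drop 1) li)
    ... | g₂ , g₃ , y , z , on′ , off′ =
      g₁ , g₃ , x , exec-loop bits y z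
      , (λ j Pj → subst (λ r′ → g₃ j ~ ([] , □ ∷ r′)) (shift-ʳ++ (l j) (r j)) (on′ j Pj))
      , (λ j Pj → trans (off′ j Pj) (off j Pj))
      where
      bits : isBit (scan g₁ i) ≡ true
      bits = cong isBit (trans (cong Tape.scanned (on i Pi))
               (scanned-∷ (~moveL (subst (λ l′ → g i ~ (l′ , r i)) li (proj₂ (at i Pi))))))

  exec-rewind : ∀ P i n (g : Tapes I) l r w → P i ≡ true →
                (∀ j → P j ≡ true → length (l j) ≡ n × g j ~ (l j , r j)) → l i ≡ map bit w →
                ∃[ g′ ] Exec (rewind P i) g (3 + n * 2) g′
                × (∀ j → P j ≡ true → g′ j ~ ([] , l j ʳ++ r j))
                × (∀ j → P j ≡ false → g′ j ≡ g j)
  exec-rewind P i n g l r w Pi at li with back P i n g l r w Pi at li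
  ... | g₁ , g₂ , x , y , on , off with exec-onlyAt P (_, R) g₂
  ... | g₃ , z , on′ , off′ =
    g₃ , subst (λ t → Exec (rewind P i) g t g₃) (cong (2 +_) (+-comm (n * 2) 1)) (exec-seq x (exec-seq y z))
    , (λ j Pj → subst (_~ ([] , l j ʳ++ r j)) (sym (on′ j Pj)) (~moveR-edge (on j Pj)))
    , (λ j Pj → trans (off′ j Pj) (off j Pj))

-- A language of polynomial-time stack programs

-- `for` repeats its body N times, where N is the length of the first input, so that
-- the running time of every program is bounded by a polynomial in N.
data Prog (k : ℕ) : Set where
  skip : Prog k
  push : Fin k → Bool → Prog k
  pop  : Fin k → Prog k
  _⨾_  : Prog k → Prog k → Prog k
  case : Fin k → (empty false true : Prog k) → Prog k
  for  : Prog k → Prog k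

infixr 4 _⨾_

Store : ℕ → Set
Store k = Vec BitString k

onTop : ∀ {A : Set} → BitString → (e f t : A) → A
onTop []          e f t = e
onTop (false ∷ _) e f t = f
onTop (true ∷ _)  e f t = t

iter : ∀ {A : Set} → ℕ → (A → A) → A → A
iter zero    f a = a
iter (suc n) f a = iter n f (f a)

run : ∀ {k} → ℕ → Prog k → Store k → Store k
run N skip           σ = σ
run N (push i b)     σ = σ [ i ]%= (b ∷_)
run N (pop i)        σ = σ [ i ]%= drop 1
run N (c ⨾ d)        σ = run N d (run N c σ)
run N (case i e f t) σ = onTop (lookup σ i) (run N e σ) (run N f σ) (run N t σ)
run N (for c)        σ = iter N (run N c) σ

-- Polynomial time bounds

_⊕_ : Polynomial → Polynomial → Polynomial
[]      ⊕ q       = q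
(a ∷ p) ⊕ []      = a ∷ p
(a ∷ p) ⊕ (b ∷ q) = a + b ∷ (p ⊕ q)

⟦⊕⟧ : ∀ p q n → ⟦ p ⊕ q ⟧ n ≡ ⟦ p ⟧ n + ⟦ q ⟧ n
⟦⊕⟧ []      q       n = refl
⟦⊕⟧ (a ∷ p) []      n = sym (+-identityʳ _)
⟦⊕⟧ (a ∷ p) (b ∷ q) n rewrite ⟦⊕⟧ p q n | *-distribˡ-+ n (⟦ p ⟧ n) (⟦ q ⟧ n) =
  interchange +-commutativeSemigroup a b (n * ⟦ p ⟧ n) (n * ⟦ q ⟧ n)

⟦⟧-mono : ∀ p {m n} → m ≤ n → ⟦ p ⟧ m ≤ ⟦ p ⟧ n
⟦⟧-mono []      h = z≤n
⟦⟧-mono (a ∷ p) h = +-monoʳ-≤ a (*-mono-≤ h (⟦⟧-mono p h))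

-- For a loop whose body costs `C`, every iteration takes `2 + C` steps for test, body and clock
-- move, the last test takes 1, and rewinding the clock takes `3 + N * 2`. The sum is
-- `4 + N * (4 + C)`. A `case` is charged for all of its branches.
cost : ∀ {k} → Prog k → Polynomial
cost skip           = 1 ∷ []
cost (push _ _)     = 2 ∷ []
cost (pop _)        = 1 ∷ []
cost (c ⨾ d)        = cost c ⊕ cost d
cost (case _ e f t) = (2 ∷ []) ⊕ (cost e ⊕ (cost f ⊕ cost t))
cost (for c)        = 4 ∷ ((4 ∷ []) ⊕ cost c)

nest : ∀ {k} → Prog k → ℕ
nest skip           = 0
nest (push _ _)     = 0
nest (pop _)        = 0
nest (c ⨾ d)        = nest c ⊔ nest d
nest (case _ e f t) = nest e ⊔ (nest f ⊔ nest t)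
nest (for c)        = suc (nest c)

marks : ℕ → List Sym
marks n = map bit (replicate n true)

marks-ʳ++ : ∀ n (xs : List Sym) → marks n ʳ++ xs ≡ marks n ++ xs
marks-ʳ++ zero    xs = refl
marks-ʳ++ (suc n) xs = trans (marks-ʳ++ n _) (snoc n)
  where
  snoc : ∀ n → marks n ++ bit true ∷ xs ≡ bit true ∷ marks n ++ xs
  snoc zero    = refl
  snoc (suc n) = cong (bit true ∷_) (snoc n)

-- Compiling stack programs to machines

module _ {K D : ℕ} where

  Index : Set
  Index = Fin K ⊎ Fin D

  _≟ᵢ_ : (i j : Index) → Dec (i ≡ j)
  _≟ᵢ_ = ⊎-≡-dec Finₚ._≟_ Finₚ._≟_

  is : Index → Index → Bool
  is i j = does (j ≟ᵢ i)

  is-refl : ∀ i → is i i ≡ true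
  is-refl i = dec-true (i ≟ᵢ i) refl

  is-≢ : ∀ {i j} → j ≢ i → is i j ≡ false
  is-≢ {i} {j} = dec-false (j ≟ᵢ i)

  is-≡ : ∀ {i j} → is i j ≡ true → j ≡ i
  is-≡ {i} {j} e with j ≟ᵢ i
  ... | yes p = p

  -- Every loop is driven by a clock tape holding N marks; nested loops use different clocks.
  compile : (c : Prog K) → nest c ≤ D → Cmd Index
  compile skip       _ = basic (λ _ s → s , S)
  compile (push i b) _ = leftAt (is (inj₁ i)) ▸ onlyAt (is (inj₁ i)) (λ _ → bit b , S)
  compile (pop i)    _ = onlyAt (is (inj₁ i)) (λ _ → □ , R)
  compile (c ⨾ d)    h = compile c (m⊔n≤o⇒m≤o _ _ h) ▸ compile d (m⊔n≤o⇒n≤o (nest c) _ h)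
  compile (case i e f t) h =
    branch (inj₁ i) isBit
      (branch (inj₁ i) isTrue
        (compile t (m⊔n≤o⇒n≤o (nest f) _ (m⊔n≤o⇒n≤o (nest e) _ h)))
        (compile f (m⊔n≤o⇒m≤o _ _ (m⊔n≤o⇒n≤o (nest e) _ h))))
      (compile e (m⊔n≤o⇒m≤o _ _ h))
  compile (for c) h =
    while clock isBit (compile c (<⇒≤ h) ▸ rightAt (is clock)) ▸ rewind (is clock) clock
    where clock = inj₂ (fromℕ< h)

  record Holds (σ : Store K) (B : Fin D → List Sym × List Sym) (g : Tapes Index) : Set where
    constructor _,_
    field
      stacks : ∀ i → g (inj₁ i) ~ ([] , map bit (lookup σ i))
      clocks : ∀ e → g (inj₂ e) ~ B e
  open Holds

  at-inj₁ : ∀ {σ B g g′ i f} → Holds σ B g →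
            g′ (inj₁ i) ~ ([] , map bit (f (lookup σ i))) →
            (∀ j → is (inj₁ i) j ≡ false → g′ j ≡ g j) →
            Holds (σ [ i ]%= f) B g′
  at-inj₁ {σ} {B} {g} {g′} {i} {f} H new old = stk , λ e → subst (_~ B e) (sym (old (inj₂ e) refl)) (clocks H e)
    where
    stk : ∀ j → g′ (inj₁ j) ~ ([] , map bit (lookup (σ [ i ]%= f) j))
    stk j with j Finₚ.≟ i
    ... | yes refl = subst (λ w → g′ (inj₁ j) ~ ([] , map bit w)) (sym (lookup∘updateAt j σ)) new
    ... | no j≢i   = subst (λ w → g′ (inj₁ j) ~ ([] , map bit w)) (sym (lookup∘updateAt′ j i j≢i σ))
                       (subst (_~ _) (sym (old (inj₁ j) (is-≢ (j≢i ∘ inj₁-injective)))) (stacks H j))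

  setClock : (Fin D → List Sym × List Sym) → Fin D → List Sym × List Sym → Fin D → List Sym × List Sym
  setClock B d a e = if does (e Finₚ.≟ d) then a else B e

  at-inj₂ : ∀ {σ B g g′ d a a′} → Holds σ (setClock B d a) g →
            g′ (inj₂ d) ~ a′ →
            (∀ j → is (inj₂ d) j ≡ false → g′ j ≡ g j) →
            Holds σ (setClock B d a′) g′
  at-inj₂ {σ} {B} {g} {g′} {d} {a} {a′} H new old =
    (λ i → subst (_~ _) (sym (old (inj₁ i) refl)) (stacks H i)) , clk
    where
    clk : ∀ e → g′ (inj₂ e) ~ setClock B d a′ e
    clk e with e Finₚ.≟ d | clocks H e
    ... | yes refl | _ = new
    ... | no e≢d   | p = subst (_~ B e) (sym (old (inj₂ e) (is-≢ (e≢d ∘ inj₂-injective)))) p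

  clock-at : ∀ {σ B g d a} → Holds σ (setClock B d a) g → g (inj₂ d) ~ a
  clock-at {d = d} H with d Finₚ.≟ d | clocks H d
  ... | yes _ | p = p
  ... | no d≢d | _ = ⊥-elim (d≢d refl)

  module _ (N : ℕ) where

    -- A loop with body `c` uses the clock numbered `nest c`, and the loops inside `c` use smaller
    -- numbers. So only clocks below the nesting depth have to stand at their start.
    Ready : ℕ → (Fin D → List Sym × List Sym) → Set
    Ready m B = ∀ e → toℕ e < m → B e ≡ ([] , marks N)

    Simulates : (c : Prog K) → nest c ≤ D → Set
    Simulates c h = ∀ σ B g → Holds σ B g → Ready (nest c) B →
      ∃[ t ] ∃[ g′ ] t ≤ ⟦ cost c ⟧ N × Exec (compile c h) g t g′ × Holds (run N c σ) B g′

    private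
      length-marks : ∀ n → length (marks n) ≡ n
      length-marks n = trans (length-map bit (replicate n true)) (length-replicate n)

      loop-bound : ∀ {t u C} r → t ≤ C → u ≤ 1 + r * (2 + C) → suc ((t + 1) + u) ≤ 1 + (suc r) * (2 + C)
      loop-bound {t} {u} {C} r p q = s≤s (begin
        (t + 1) + u                 ≡⟨ cong (_+ u) (+-comm t 1) ⟩
        suc t + u                   ≤⟨ +-mono-≤ (s≤s p) q ⟩
        suc C + suc (r * (2 + C))   ≡⟨ +-suc (suc C) _ ⟩
        (2 + C) + r * (2 + C)       ∎)
        where open ≤-Reasoning

      total-bound : ∀ {t C} → t ≤ 1 + N * (2 + C) → t + (3 + N * 2) ≤ 4 + N * (4 + C)
      total-bound {t} {C} p = begin
        t + (3 + N * 2)               ≤⟨ +-monoˡ-≤ _ p ⟩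
        1 + N * (2 + C) + (3 + N * 2) ≡⟨ +-comm (1 + N * (2 + C)) (3 + N * 2) ⟩
        3 + N * 2 + (1 + N * (2 + C)) ≡⟨ +-suc (3 + N * 2) _ ⟩
        4 + (N * 2 + N * (2 + C))     ≡⟨ cong (4 +_) (sym (*-distribˡ-+ N 2 (2 + C))) ⟩
        4 + N * (4 + C)               ∎
        where open ≤-Reasoning

    module _ (c : Prog K) (h : nest c < D) (body : Simulates c (<⇒≤ h)) where

      private
        d : Fin D
        d = fromℕ< h
        C : ℕ
        C = ⟦ cost c ⟧ N
        loop : Cmd Index
        loop = while (inj₂ d) isBit (compile c (<⇒≤ h) ▸ rightAt (is (inj₂ d)))

        below : ∀ {B a} → Ready (nest c) B → Ready (nest c) (setClock B d a)
        below ready e e<c with e Finₚ.≟ d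
        ... | yes refl = ⊥-elim (<-irrefl (Finₚ.toℕ-fromℕ< h) e<c)
        ... | no _     = ready e e<c

      -- The position of clock `d` splits its marks into `j` iterations done and `r` to come. The
      -- body preserves this split, as its own clocks lie below `d`.
      exec-iterations : ∀ r j {σ B g} → Ready (nest c) B → Holds σ (setClock B d (marks j , marks r)) g →
        ∃[ t ] ∃[ g′ ] t ≤ 1 + r * (2 + C) × Exec loop g t g′
        × Holds (iter r (run N c) σ) (setClock B d (marks (r + j) , [])) g′
      exec-iterations zero    j ready H = 1 , _ , ≤-refl , exec-stop (cong isBit (scanned-[] (clock-at H))) , H
      exec-iterations (suc r) j {σ} {B} {g} ready H
        with body σ _ g H (below ready)
      ... | t , g₁ , t≤ , x , H₁ with exec-onlyAt (is (inj₂ d)) (_, R) g₁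
      ... | g₂ , y , on , off
        with exec-iterations r (suc j) ready
               (at-inj₂ H₁ (subst (_~ (marks (suc j) , marks r)) (sym (on (inj₂ d) (is-refl (inj₂ d))))
                             (~moveR (clock-at H₁))) off)
      ... | u , g₃ , u≤ , z , H₃ =
        _ , g₃ , loop-bound r t≤ u≤
        , exec-loop (cong isBit (scanned-∷ (clock-at H))) (exec-seq x y) z
        , subst (λ n → Holds (iter r (run N c) (run N c σ)) (setClock B d (marks n , [])) g₃) (+-suc r j) H₃

      exec-for : Simulates (for c) h
      exec-for σ B g H ready
        with exec-iterations N 0 (λ e e<c → ready e (m<n⇒m<1+n e<c)) start
        where
        start : Holds σ (setClock B d ([] , marks N)) g
        start = stacks H , clk
          where
          clk : ∀ e → g (inj₂ e) ~ setClock B d ([] , marks N) e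
          clk e with e Finₚ.≟ d
          ... | yes refl = subst (g (inj₂ e) ~_) (ready e (s≤s (≤-reflexive (Finₚ.toℕ-fromℕ< h)))) (clocks H e)
          ... | no _     = clocks H e
      ... | t , g₁ , t≤ , x , H₁
        with exec-rewind (is (inj₂ d)) (inj₂ d) N g₁ (λ _ → marks N) (λ _ → []) (replicate N true)
               (is-refl (inj₂ d)) (λ j e → length-marks N , at-clock (is-≡ e)) refl
        where
        at-clock : ∀ {j} → j ≡ inj₂ d → g₁ j ~ (marks N , [])
        at-clock refl = subst (λ n → g₁ (inj₂ d) ~ (marks n , [])) (+-identityʳ N) (clock-at H₁)
      ... | g₂ , y , on , off =
        t + (3 + N * 2) , g₂
        , subst (t + (3 + N * 2) ≤_) (cong (λ z → 4 + N * z) (sym (⟦⊕⟧ (4 ∷ []) (cost c) N)))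
            (subst (λ z → t + (3 + N * 2) ≤ 4 + N * (4 + z + C)) (sym (*-zeroʳ N)) (total-bound t≤))
        , exec-seq x y , stacks H₂ , clk
        where
        H₂ : Holds (iter N (run N c) σ) (setClock B d ([] , marks N)) g₂
        H₂ = at-inj₂ H₁ (subst (λ l → g₂ (inj₂ d) ~ ([] , l))
                          (trans (marks-ʳ++ N []) (++-identityʳ (marks N)))
                          (on (inj₂ d) (is-refl (inj₂ d)))) off
        clk : ∀ e → g₂ (inj₂ e) ~ B e
        clk e with e Finₚ.≟ d | clocks H₂ e
        ... | yes refl | p = subst (g₂ (inj₂ e) ~_) (sym (ready e (s≤s (≤-reflexive (Finₚ.toℕ-fromℕ< h))))) p
        ... | no _     | p = p

    private
      weaken : ∀ {m n B} → m ≤ n → Ready n B → Ready m B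
      weaken m≤n ready e e<m = ready e (≤-trans e<m m≤n)

      case-bound : ∀ {t} (i : Fin K) (e f u : Prog K) {X} → t ≤ 2 + X →
                   X ≤ ⟦ cost e ⟧ N + (⟦ cost f ⟧ N + ⟦ cost u ⟧ N) → t ≤ ⟦ cost (case i e f u) ⟧ N
      case-bound i e f u p q
        rewrite ⟦⊕⟧ (2 ∷ []) (cost e ⊕ (cost f ⊕ cost u)) N
              | ⟦⊕⟧ (cost e) (cost f ⊕ cost u) N | ⟦⊕⟧ (cost f) (cost u) N | *-zeroʳ N
        = ≤-trans p (+-monoʳ-≤ 2 q)

    exec-compile : ∀ c h → Simulates c h
    exec-compile skip h σ B g H ready = 1 , g , s≤s z≤n , exec-basic , H
    exec-compile (push i b) h σ B g H ready with exec-onlyAt (is (inj₁ i)) (_, L) g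
    ... | g₁ , x , on , off with exec-onlyAt (is (inj₁ i)) (λ _ → bit b , S) g₁
    ... | g₂ , y , on′ , off′ =
      2 , g₂ , s≤s (s≤s z≤n) , exec-seq x y
      , at-inj₁ H (subst (_~ _) (sym (on′ _ (is-refl (inj₁ i))))
                    (~write (bit b) (subst (_~ _) (sym (on _ (is-refl (inj₁ i)))) (~moveL-edge (stacks H i)))))
                  (λ j e → trans (off′ j e) (off j e))
    exec-compile (pop i) h σ B g H ready with exec-onlyAt (is (inj₁ i)) (λ _ → □ , R) g
    ... | g₁ , x , on , off =
      1 , g₁ , s≤s z≤n , x
      , at-inj₁ H (subst (_~ _) (sym (on _ (is-refl (inj₁ i))))
                    (subst (λ l → _ ~ ([] , l)) (drop-map (lookup σ i)) (~erase (stacks H i)))) off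
      where
      drop-map : ∀ w → drop 1 (map bit w) ≡ map bit (drop 1 w)
      drop-map []      = refl
      drop-map (_ ∷ _) = refl
    exec-compile (c ⨾ d) h σ B g H ready
      with exec-compile c _ σ B g H (weaken (m≤m⊔n (nest c) (nest d)) ready)
    ... | t , g₁ , t≤ , x , H₁
      with exec-compile d (m⊔n≤o⇒n≤o (nest c) _ h) _ B g₁ H₁ (weaken (m≤n⊔m (nest c) (nest d)) ready)
    ... | u , g₂ , u≤ , y , H₂ =
      t + u , g₂ , subst (t + u ≤_) (sym (⟦⊕⟧ (cost c) (cost d) N)) (+-mono-≤ t≤ u≤) , exec-seq x y , H₂
    exec-compile (case i e f u) h σ B g H ready with lookup σ i | stacks H i
    ... | [] | top
      with exec-compile e (m⊔n≤o⇒m≤o _ _ h) σ B g H (weaken (m≤m⊔n (nest e) _) ready)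
    ... | t , g₁ , t≤ , x , H₁ =
      suc t , g₁ , case-bound i e f u (≤-trans (s≤s t≤) (n≤1+n _)) (m≤m+n _ _)
      , exec-false (cong isBit (scanned-[] top)) x , H₁
    exec-compile (case i e f u) h σ B g H ready | false ∷ _ | top
      with exec-compile f (m⊔n≤o⇒m≤o _ _ (m⊔n≤o⇒n≤o (nest e) _ h)) σ B g H
             (weaken (≤-trans (m≤m⊔n (nest f) (nest u)) (m≤n⊔m (nest e) _)) ready)
    ... | t , g₁ , t≤ , x , H₁ =
      2 + t , g₁ , case-bound i e f u (s≤s (s≤s t≤)) (≤-trans (m≤m+n _ _) (m≤n+m _ (⟦ cost e ⟧ N)))
      , exec-true (cong isBit (scanned-∷ top)) (exec-false (cong isTrue (scanned-∷ top)) x) , H₁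
    exec-compile (case i e f u) h σ B g H ready | true ∷ _ | top
      with exec-compile u (m⊔n≤o⇒n≤o (nest f) _ (m⊔n≤o⇒n≤o (nest e) _ h)) σ B g H
             (weaken (≤-trans (m≤n⊔m (nest f) (nest u)) (m≤n⊔m (nest e) _)) ready)
    ... | t , g₁ , t≤ , x , H₁ =
      2 + t , g₁ , case-bound i e f u (s≤s (s≤s t≤)) (≤-trans (m≤n+m _ (⟦ cost f ⟧ N)) (m≤n+m _ (⟦ cost e ⟧ N)))
      , exec-true (cong isBit (scanned-∷ top)) (exec-true (cong isTrue (scanned-∷ top)) x) , H₁
    exec-compile (for c) h = exec-for c h (exec-compile c (<⇒≤ h))

-- The complete machine: preparing the clocks, input and output

~append : ∀ {t l} y → t ~ (l , []) → move R (write y t) ~ (y ∷ l , [])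
~append {tape _ _ []}      y (p , (□∷ [])) = (keep p) , (□∷ [])
~append {tape _ _ (_ ∷ _)} y (p , (□∷ q))  = (keep p) , q

blank-~ : tape [] □ [] ~ ([] , [])
blank-~ = [] , (□∷ [])

module _ {k : ℕ} (c : Prog (4 + k)) where

  private
    I′ : Set
    I′ = Fin (4 + k) ⊎ Fin (nest c)

    filled : I′ → Bool
    filled (inj₁ zero)    = true
    filled (inj₁ (suc _)) = false
    filled (inj₂ _)       = true

    mark : I′ → Sym → Sym × Move
    mark (inj₁ zero)    s = s , R
    mark (inj₁ (suc _)) s = s , S
    mark (inj₂ _)       s = bit true , R

    marking : Cmd I′
    marking = while (inj₁ zero) isBit (basic mark)

  -- Writes one mark on every clock tape for each bit of the first input.
  program : Cmd I′
  program = (marking ▸ rewind filled (inj₁ zero)) ▸ compile c ≤-refl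

  private
    -- All clocks are filled during a single pass over the input. Their heads end as far from the
    -- start as the input head, so one common `rewind` serves them all.
    exec-marking : ∀ w u (g : Tapes I′) → g (inj₁ zero) ~ (map bit u , map bit w) →
      (∀ e → g (inj₂ e) ~ (marks (length u) , [])) →
      ∃[ g′ ] Exec marking g (1 + length w * 2) g′
      × g′ (inj₁ zero) ~ (map bit (w ʳ++ u) , [])
      × (∀ e → g′ (inj₂ e) ~ (marks (length w + length u) , []))
      × (∀ i → g′ (inj₁ (suc i)) ≡ g (inj₁ (suc i)))
    exec-marking [] u g p q = g , exec-stop (cong isBit (scanned-[] p)) , p , q , λ _ → refl
    exec-marking (b ∷ w) u g p q
      with exec-marking w (b ∷ u) _ (~moveR p) (λ e → ~append (bit true) (q e))
    ... | g′ , x , p′ , q′ , r =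
      g′ , exec-loop (cong isBit (scanned-∷ p)) exec-basic x , p′
      , (λ e → subst (λ n → g′ (inj₂ e) ~ (marks n , [])) (+-suc (length w) (length u)) (q′ e))
      , r

    store : Vec BitString 3 → Store (4 + k)
    store ws = ws Vec.++ Vec.replicate (suc k) []

    exec-program : ∀ w a b (g : Tapes I′) → let σ = store (w ∷ a ∷ b ∷ []) ; N = length w in
      (∀ i → g (inj₁ i) ~ ([] , map bit (lookup σ i))) →
      (∀ e → g (inj₂ e) ~ ([] , [])) →
      ∃[ t ] ∃[ g′ ] t ≤ (4 + N * 4) + ⟦ cost c ⟧ N × Exec program g t g′
      × (∀ i → g′ (inj₁ i) ~ ([] , map bit (lookup (run N c σ) i)))
    exec-program w a b g p q with exec-marking w [] g (p zero) q
    ... | g₁ , x , p₁ , q₁ , r₁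
      with exec-rewind filled (inj₁ zero) (length w) g₁ lefts (λ _ → []) (w ʳ++ []) refl at refl
      where
      lefts : I′ → List Sym
      lefts (inj₁ _) = map bit (w ʳ++ [])
      lefts (inj₂ _) = marks (length w)
      at : ∀ j → filled j ≡ true → length (lefts j) ≡ length w × g₁ j ~ (lefts j , [])
      at (inj₁ zero) _ =
        trans (length-map bit (w ʳ++ [])) (trans (length-ʳ++ w) (+-identityʳ _)) , p₁
      at (inj₂ e) _ =
        trans (length-map bit (replicate (length w) true)) (length-replicate (length w))
        , subst (λ n → g₁ (inj₂ e) ~ (marks n , [])) (+-identityʳ _) (q₁ e)
    ... | g₂ , y , on , off
      with exec-compile (length w) c ≤-refl (store (w ∷ a ∷ b ∷ [])) (λ _ → [] , marks (length w)) g₂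
             (stk , λ e → subst (λ l → g₂ (inj₂ e) ~ ([] , l)) (marks-reverse (length w)) (on (inj₂ e) refl))
             (λ _ _ → refl)
      where
      stk : ∀ i → g₂ (inj₁ i) ~ ([] , map bit (lookup (store (w ∷ a ∷ b ∷ [])) i))
      stk zero = subst (λ l → g₂ (inj₁ zero) ~ ([] , l)) unreverse (on (inj₁ zero) refl)
        where
        unreverse : map bit (w ʳ++ []) ʳ++ [] ≡ map bit w
        unreverse = trans (sym (map-ʳ++ bit (w ʳ++ [])))
                          (cong (map bit) (trans (ʳ++-ʳ++ w) (++-identityʳ w)))
      stk (suc i) = subst (_~ ([] , map bit (lookup (a ∷ b ∷ Vec.replicate (suc k) []) i)))
                      (sym (trans (off (inj₁ (suc i)) refl) (r₁ i))) (p (suc i))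
      marks-reverse : ∀ n → marks n ʳ++ [] ≡ marks n
      marks-reverse n = trans (marks-ʳ++ n []) (++-identityʳ _)
    ... | t , g₃ , t≤ , z , H =
      _ , g₃ , ≤-trans (≤-reflexive (cong (_+ t) (bound (length w)))) (+-monoʳ-≤ (4 + length w * 4) t≤)
      , exec-seq (exec-seq x y) z , Holds.stacks H
      where
      bound : ∀ n → (1 + n * 2) + (3 + n * 2) ≡ 4 + n * 4
      bound n = trans (+-comm (1 + n * 2) (3 + n * 2)) (trans (+-suc (3 + n * 2) _) (cong (4 +_) (sym (*-distribˡ-+ n 2 2))))

    inputTape-~ : ∀ w → inputTape (machine program) w ~ ([] , map bit w)
    inputTape-~ []      = [] , (□∷ [])
    inputTape-~ (b ∷ w) = [] , ⊑-refl (bit b ∷ map bit w)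
      where
      ⊑-refl : ∀ xs → xs ⊑ xs
      ⊑-refl []       = []
      ⊑-refl (_ ∷ xs) = keep (⊑-refl xs)

    leadingBits-⊑ : ∀ w {ys} → map bit w ⊑ ys → leadingBits (machine program) ys ≡ w
    leadingBits-⊑ []      []       = refl
    leadingBits-⊑ []      (□∷ _)   = refl
    leadingBits-⊑ (b ∷ w) (keep p) = cong (b ∷_) (leadingBits-⊑ w p)

    output-lookup : ∀ {q} ts {w} → lookup ts (suc (suc (suc zero))) ~ ([] , map bit w) →
                    output (machine program) (q , ts) ≡ w
    output-lookup (_ ∷ _ ∷ _ ∷ _ ∷ _) {w} (_ , p) = leadingBits-⊑ w p

  outcome : Vec BitString 3 → BitString
  -- Register 3 is the output tape, which comes after the three inputs.
  outcome ws = lookup (run (length (Vec.head ws)) c (ws Vec.++ Vec.replicate (suc k) [])) (suc (suc (suc zero)))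

  private
    blank : ∀ {n} (i : Fin n) → lookup (Vec.replicate n (tape [] □ [])) i ~ ([] , [])
    blank i = subst (_~ ([] , [])) (sym (lookup-replicate i (tape [] □ []))) blank-~

    time : Polynomial
    time = (4 ∷ 4 ∷ []) ⊕ cost c

    module _ (w a b : BitString) where

      startTapes : Vec (Tape 0) (4 + k + nest c)
      startTapes = proj₂ (initial (machine program) (w ∷ a ∷ b ∷ []))

      start-stacks : ∀ i → lookup startTapes (i ↑ˡ nest c) ~ ([] , map bit (lookup (store (w ∷ a ∷ b ∷ [])) i))
      start-stacks zero                = inputTape-~ w
      start-stacks (suc zero)          = inputTape-~ a
      start-stacks (suc (suc zero))    = inputTape-~ b
      start-stacks (suc (suc (suc i))) =
        subst (λ v → lookup (Vec.replicate (suc k + nest c) (tape [] □ [])) (i ↑ˡ nest c) ~ ([] , map bit v))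
              (sym (lookup-replicate i [])) (blank (i ↑ˡ nest c))

      time-bound : ∀ {t} → t ≤ (4 + length w * 4) + ⟦ cost c ⟧ (length w) →
                   t ≤ ⟦ time ⟧ (totalLength (w ∷ a ∷ b ∷ []))
      time-bound {t} t≤ = begin
        t                                         ≤⟨ t≤ ⟩
        (4 + N * 4) + ⟦ cost c ⟧ N                ≡⟨ cong (λ z → 4 + N * (4 + z) + ⟦ cost c ⟧ N) (sym (*-zeroʳ N)) ⟩
        ⟦ 4 ∷ 4 ∷ [] ⟧ N + ⟦ cost c ⟧ N           ≡⟨ sym (⟦⊕⟧ (4 ∷ 4 ∷ []) (cost c) N) ⟩
        -- The bound is in the length of the first input alone; monotonicity passes to the total
        -- length.
        ⟦ time ⟧ N                                ≤⟨ ⟦⟧-mono time (m≤m+n N _) ⟩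
        ⟦ time ⟧ (totalLength (w ∷ a ∷ b ∷ []))   ∎
        where
        open ≤-Reasoning
        N = length w

  outcome-polyTime : PolyTime outcome
  outcome-polyTime = machine program , time , computes
    where
    computes : ComputesInTime (machine program) time outcome
    computes (w ∷ a ∷ b ∷ []) =
      let t , g , t≤ , x , H =
            exec-program w a b (λ i → lookup (startTapes w a b) (join (4 + k) (nest c) i))
              (start-stacks w a b) (λ e → blank (suc k ↑ʳ e))
          ts , halted , shows = simulate program x (startTapes w a b) (λ _ → refl)
          out = suc (suc (suc zero))
      in t , (nothing , ts) , time-bound w a b t≤ , halted
       , output-lookup {nothing} ts (subst (_~ ([] , map bit (outcome (w ∷ a ∷ b ∷ [])))) (sym (shows (inj₁ out))) (H out))

-- Lexicographic comparison

-- The result serves as a verdict: `true` if the first string is smaller.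
cmp : BitString → BitString → BitString
cmp (false ∷ xs) (false ∷ ys) = cmp xs ys
cmp (true  ∷ xs) (true  ∷ ys) = cmp xs ys
cmp (false ∷ _)  (true  ∷ _)  = true ∷ []
cmp (true  ∷ _)  (false ∷ _)  = false ∷ []
cmp _            _            = []

cmp-refl : ∀ xs → cmp xs xs ≡ []
cmp-refl []           = refl
cmp-refl (false ∷ xs) = cmp-refl xs
cmp-refl (true  ∷ xs) = cmp-refl xs

cmp-swap : ∀ xs ys → cmp ys xs ≡ map not (cmp xs ys)
cmp-swap []           []           = refl
cmp-swap []           (false ∷ _)  = refl
cmp-swap []           (true ∷ _)   = refl
cmp-swap (false ∷ _)  []           = refl
cmp-swap (true ∷ _)   []           = refl
cmp-swap (false ∷ xs) (false ∷ ys) = cmp-swap xs ys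
cmp-swap (false ∷ _)  (true ∷ _)   = refl
cmp-swap (true ∷ _)   (false ∷ _)  = refl
cmp-swap (true ∷ xs)  (true ∷ ys)  = cmp-swap xs ys

cmp-≢ : ∀ {n} (u v : Vec Bool n) → u ≢ v → ∃[ b ] cmp (toList u) (toList v) ≡ b ∷ []
cmp-≢ []          []          u≢v = ⊥-elim (u≢v refl)
cmp-≢ (false ∷ u) (false ∷ v) u≢v = cmp-≢ u v (u≢v ∘ cong (false ∷_))
cmp-≢ (true ∷ u)  (true ∷ v)  u≢v = cmp-≢ u v (u≢v ∘ cong (true ∷_))
cmp-≢ (false ∷ u) (true ∷ v)  _   = true , refl
cmp-≢ (true ∷ u)  (false ∷ v) _   = false , refl

Least : ∀ {n} → (Vec Bool n → Set) → Vec Bool n → Set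
Least P v = P v × (∀ v′ → P v′ → v′ ≢ v → cmp (toList v) (toList v′) ≡ true ∷ [])

-- This brute-force search only serves to show that a correct history exists; the verifier never
-- performs it. Strings starting with `false` come first in the order, so that half is searched
-- first.
least? : ∀ n {P : Vec Bool n → Set} → (∀ v → Dec (P v)) → (∃[ v ] Least P v) ⊎ (∀ v → ¬ P v)
least? zero P? with P? []
... | yes p = inj₁ ([] , p , λ { [] _ []≢[] → ⊥-elim ([]≢[] refl) })
... | no ¬p = inj₂ λ { [] → ¬p }
least? (suc n) P? with least? n (P? ∘ (false ∷_))
... | inj₁ (v , p , min) = inj₁ (false ∷ v , p , λ
  { (false ∷ v′) p′ v′≢v → min v′ p′ (v′≢v ∘ cong (false ∷_))
  ; (true ∷ v′)  p′ v′≢v → refl })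
... | inj₂ none with least? n (P? ∘ (true ∷_))
...   | inj₁ (v , p , min) = inj₁ (true ∷ v , p , λ
  { (false ∷ v′) p′ v′≢v → ⊥-elim (none v′ p′)
  ; (true ∷ v′)  p′ v′≢v → min v′ p′ (v′≢v ∘ cong (true ∷_)) })
...   | inj₂ none′ = inj₂ λ { (false ∷ v) → none v ; (true ∷ v) → none′ v }

differ : BitString → Bool
differ []      = false
differ (_ ∷ _) = true

differ-not : ∀ xs → differ (map not xs) ≡ differ xs
differ-not []      = refl
differ-not (_ ∷ _) = refl

toList-injective : ∀ {n} (u v : Vec Bool n) → toList u ≡ toList v → u ≡ v
toList-injective []      []      _ = refl
toList-injective (_ ∷ u) (_ ∷ v) e = cong₂ _∷_ (∷-injectiveˡ e) (toList-injective u v (∷-injectiveʳ e))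

toList-++-injective : ∀ {n} (a a′ : Vec Bool n) {ys ys′} → toList a ++ ys ≡ toList a′ ++ ys′ → a ≡ a′ × ys ≡ ys′
toList-++-injective []      []       e = refl , e
toList-++-injective (_ ∷ a) (_ ∷ a′) e with toList-++-injective a a′ (∷-injectiveʳ e)
... | p , q = cong₂ _∷_ (∷-injectiveˡ e) p , q

-- Counting strings

toFin : ∀ {n} → Vec Bool n → Fin (2 ^ n)
toFin []          = zero
toFin (false ∷ v) = combine {2} zero (toFin v)
toFin (true ∷ v)  = combine {2} (suc zero) (toFin v)

toBool : Fin 2 → Bool
toBool zero    = false
toBool (suc _) = true

ofFin : ∀ n → Fin (2 ^ n) → Vec Bool n
ofFin zero    _ = []
ofFin (suc n) i = toBool (proj₁ (remQuot {2} (2 ^ n) i)) ∷ ofFin n (proj₂ (remQuot {2} (2 ^ n) i))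

ofFin-toFin : ∀ {n} (v : Vec Bool n) → ofFin n (toFin v) ≡ v
ofFin-toFin []                  = refl
ofFin-toFin {suc n} (false ∷ v) =
  trans (cong (λ r → toBool (proj₁ r) ∷ ofFin n (proj₂ r)) (Finₚ.remQuot-combine {2} {2 ^ n} zero (toFin v)))
        (cong (false ∷_) (ofFin-toFin v))
ofFin-toFin {suc n} (true ∷ v) =
  trans (cong (λ r → toBool (proj₁ r) ∷ ofFin n (proj₂ r)) (Finₚ.remQuot-combine {2} {2 ^ n} (suc zero) (toFin v)))
        (cong (true ∷_) (ofFin-toFin v))

toFin-ofFin : ∀ n (i : Fin (2 ^ n)) → toFin (ofFin n i) ≡ i
toFin-ofFin zero    zero = refl
toFin-ofFin (suc n) i =
  trans (split (proj₁ r) (proj₂ r)) (Finₚ.combine-remQuot {2} (2 ^ n) i)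
  where
  r = remQuot {2} (2 ^ n) i
  split : ∀ c j → toFin (toBool c ∷ ofFin n j) ≡ combine {2} c j
  split zero       j = cong (combine {2} zero) (toFin-ofFin n j)
  split (suc zero) j = cong (combine {2} (suc zero)) (toFin-ofFin n j)

-- A choice of preimages would inject `2 ^ (n + n)` strings into `2 ^ n` for `n = suc m`. The length
-- is a successor because for length 0 the map is onto.
doubling-not-onto : ∀ m (f : Vec Bool (suc m) → Vec Bool (suc m + suc m)) → ¬ (∀ y → ∃[ x ] f x ≡ y)
doubling-not-onto m f onto =
  <⇒≱ (^-monoʳ-< 2 (s≤s (s≤s z≤n)) (m<m+n (suc m) (s≤s z≤n)))
      (Finₚ.injective⇒≤ {f = λ i → toFin (pre (ofFin (suc m + suc m) i))} inj)
  where
  pre : Vec Bool (suc m + suc m) → Vec Bool (suc m)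
  pre y = proj₁ (onto y)
  inj : ∀ {i j} → toFin (pre (ofFin _ i)) ≡ toFin (pre (ofFin _ j)) → i ≡ j
  inj {i} {j} e = trans (sym (toFin-ofFin (suc m + suc m) i)) (trans (cong toFin y≡) (toFin-ofFin (suc m + suc m) j))
    where
    x≡ : pre (ofFin _ i) ≡ pre (ofFin _ j)
    x≡ = trans (sym (ofFin-toFin _)) (trans (cong (ofFin _) e) (ofFin-toFin _))
    y≡ : ofFin (suc m + suc m) i ≡ ofFin (suc m + suc m) j
    y≡ = trans (sym (proj₂ (onto _))) (trans (cong f x≡) (proj₂ (onto _)))

-- Histories

Top : Bool → BitString → Set
Top b W = ∃[ W′ ] W ≡ b ∷ W′

-- The node of the tree at path p of length k below 2n carries the concatenation of its
-- children's values; the leaves carry all strings of length 2n.  A history lists, from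
-- the root downwards, the nodes whose value has not been computed.  There, `true` marks
-- a child without a value; if both children have values, then their concatenation has
-- no preimage.
module Korten {n : ℕ} (f : Vec Bool n → Vec Bool n × Vec Bool n) where

  record Block : Set where
    constructor block
    field
      kˡ kʳ : Bool
      a b   : Vec Bool n
  open Block

  -- An unfinished node keeps the filler bits of its slot in the block. All children then have
  -- encodings of equal length, as the comparison program requires.
  data State : Set where
    done : Vec Bool n → State
    partial : BitString → State

  -- The tag lets one lexicographic comparison implement two rules: finished beats unfinished, and a
  -- smaller value beats a larger one.
  str : State → BitString
  str (done v) = false ∷ toList v
  str (partial j) = true ∷ j

  isPartial : State → Bool
  isPartial (done _) = false
  isPartial (partial _) = true

  child : Bool → Vec Bool n → State
  child false v = done v
  child true  v = partial (toList v)

  left right : Block → State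
  left  B = child (kˡ B) (a B)
  right B = child (kʳ B) (b B)

  image : Vec Bool n → Block
  image v = block false false (proj₁ (f v)) (proj₂ (f v))

  headBlock : List Block → Block
  -- Kinds 11 cannot be mistaken for a stop, on which `extract-stop` relies.
  headBlock []      = block true true (Vec.replicate n false) (Vec.replicate n false)
  headBlock (B ∷ _) = B

  current : State → List Block → Block
  current (done v) h = image v
  current (partial _) h = headBlock h

  rest : State → List Block → List Block
  rest (done _) h = h
  rest (partial _) h = drop 1 h

  -- Blocks are read from a stack, so their bits are stored in reverse.
  encB : Block → BitString
  encB B = (toList (a B) ++ toList (b B)) ʳ++ kˡ B ∷ kʳ B ∷ []

  -- The encoding of the stopped block (kinds 00) whose string spells the path.
  leaf : BitString → BitString
  leaf p = p ++ false ∷ false ∷ []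

  bad : Block → BitString → Bool
  bad B p = not (does (Listₚ.≡-dec Boolₚ._≟_ (encB B) (leaf p)))

  -- `W` is the stack of verdicts, the latest on top, because a disagreement further down overrules
  -- those above it. An unfinished left child is entered even without a disagreement: in postorder
  -- nothing to its right has a value yet. That only the first player is asked about this is no
  -- asymmetry, by `left-swap`.
  walk : ℕ → BitString → State → List Block → State → List Block → BitString → BitString
  walk zero p s₁ h₁ s₂ h₂ W =
    cmp (bad (current s₁ h₁) p ∷ []) (bad (current s₂ h₂) p ∷ []) ++ W
  walk (suc k) p s₁ h₁ s₂ h₂ W =
    let B₁ = current s₁ h₁
        B₂ = current s₂ h₂
        r  = cmp (str (left B₁)) (str (left B₂))
        r′ = cmp (str (right B₁)) (str (right B₂))
    in if isPartial (left B₁) ∨ differ r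
       then walk k (false ∷ p) (left B₁) (rest s₁ h₁) (left B₂) (rest s₂ h₂) (r ++ W)
       else walk k (true ∷ p) (right B₁) (rest s₁ h₁) (right B₂) (rest s₂ h₂) (r′ ++ W)

  extract : List Block → Maybe BitString
  extract []                          = nothing
  extract (block false false a b ∷ _) = just (toList a ++ toList b)
  extract (block true _ _ _ ∷ h)      = extract h
  extract (block false true _ _ ∷ h)  = extract h

  encB-injective : ∀ {B B′} → encB B ≡ encB B′ → B ≡ B′
  encB-injective {block k l a b} {block k′ l′ a′ b′} e
    with trans (sym (ʳ++-ʳ++ (toList a ++ toList b))) (trans (cong (_ʳ++ []) e) (ʳ++-ʳ++ (toList a′ ++ toList b′)))
  ... | e′ with ∷-injectiveˡ e′ | ∷-injectiveˡ (∷-injectiveʳ e′) | ∷-injectiveʳ (∷-injectiveʳ e′)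
  ... | refl | refl | e″
    with toList-++-injective a a′
           (trans (sym (++-identityʳ _)) (trans e″ (++-identityʳ _)))
  ... | refl , e‴ = cong (block k l a) (toList-injective b b′ e‴)

  bad-leaf : ∀ {B p} → encB B ≡ leaf p → bad B p ≡ false
  bad-leaf {B} {p} e with Listₚ.≡-dec Boolₚ._≟_ (encB B) (leaf p)
  ... | yes _ = refl
  ... | no ne = ⊥-elim (ne e)

  good-leaf : ∀ {B p} → bad B p ≡ false → encB B ≡ leaf p
  good-leaf {B} {p} e with Listₚ.≡-dec Boolₚ._≟_ (encB B) (leaf p)
  ... | yes q = q

  Minimal : Vec Bool n → Set
  Minimal v = ∀ v′ → f v′ ≡ f v → v′ ≢ v → cmp (toList v) (toList v′) ≡ true ∷ []

  -- The strings of inner nodes need not be mentioned: `f v` is the concatenation of the children's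
  -- values, and only the leaves are tied to their paths.
  Done : ℕ → BitString → Vec Bool n → Set
  Done zero    p v = encB (image v) ≡ leaf p × Minimal v
  Done (suc k) p v = (Done k (false ∷ p) (proj₁ (f v)) × Done k (true ∷ p) (proj₂ (f v))) × Minimal v

  minimal : ∀ k {p v} → Done k p v → Minimal v
  minimal zero    d = proj₂ d
  minimal (suc k) d = proj₂ d

  Missed : Vec Bool n → Vec Bool n → Set
  Missed a b = ∀ v → f v ≢ (a , b)

  -- The slots of uncomputed children and the blocks after the stop are arbitrary, so a correct
  -- history has to prevail whatever its filler is.
  data Partial : ℕ → BitString → List Block → Set where
    atLeaf : ∀ {p a b h} → encB (block false false a b) ≡ leaf p → Missed a b →
             Partial 0 p (block false false a b ∷ h)
    inLeft : ∀ {k p l a b h} → Partial k (false ∷ p) h → Partial (suc k) p (block true l a b ∷ h)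
    inRight : ∀ {k p a b h} → Done k (false ∷ p) a → Partial k (true ∷ p) h →
              Partial (suc k) p (block false true a b ∷ h)
    here : ∀ {k p a b h} → Done k (false ∷ p) a → Done k (true ∷ p) b → Missed a b →
           Partial (suc k) p (block false false a b ∷ h)

  -- The walk, seen from a first player whose history is correct

  walk-same : ∀ k p v h₁ h₂ W → walk k p (done v) h₁ (done v) h₂ W ≡ W
  walk-same zero p v h₁ h₂ W rewrite cmp-refl (bad (image v) p ∷ []) = refl
  walk-same (suc k) p v h₁ h₂ W
    rewrite cmp-refl (toList (proj₁ (f v))) | cmp-refl (toList (proj₂ (f v))) =
    walk-same k (true ∷ p) (proj₂ (f v)) h₁ h₂ W

  -- This is the invariant below a correct finished node: the latest verdict is favourable, or the
  -- blocks still differ and a later verdict is bound to come.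
  Ahead : Vec Bool n → State → List Block → BitString → Set
  Ahead v s h W = Top true W ⊎ current s h ≢ image v

  data Compared (v : Vec Bool n) (s : State) (h : List Block) (W : BitString) : Set where
    equal  : s ≡ done v → cmp (str (done v)) (str s) ≡ [] → Compared v s h W
    unlike : ∀ b → cmp (str (done v)) (str s) ≡ b ∷ [] → Ahead v s h (b ∷ W) → Compared v s h W

  image-injective : ∀ {v v′} → image v ≡ image v′ → f v ≡ f v′
  image-injective e = cong₂ _,_ (cong a e) (cong b e)

  -- Different values with equal images are decided by minimality. Different values with different
  -- images may receive either verdict, since the disagreement survives in their blocks.
  compare : ∀ {v} s h W → Minimal v → Compared v (uncurry child s) h W
  compare (true , _) h W min = unlike true refl (inj₁ (_ , refl))
  compare {v} (false , v′) h W min with Vecₚ.≡-dec Boolₚ._≟_ v′ v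
  ... | yes refl = equal refl (cmp-refl (toList v))
  ... | no v′≢v with ×-≡-dec (Vecₚ.≡-dec Boolₚ._≟_) (Vecₚ.≡-dec Boolₚ._≟_) (f v′) (f v)
  ...   | yes e = unlike true (min v′ e v′≢v) (inj₁ (_ , refl))
  ...   | no ne with cmp-≢ v v′ (v′≢v ∘ sym)
  ...     | b , e = unlike b e (inj₂ (ne ∘ image-injective))

  child-done : ∀ {k v v′} → child k v ≡ done v′ → k ≡ false × v ≡ v′
  child-done {false} refl = refl , refl

  child-partial : ∀ {k v j} → child k v ≡ partial j → k ≡ true
  child-partial {true} _ = refl

  block-η : ∀ {B l r a′ b′} → left B ≡ done a′ → right B ≡ done b′ → l ≡ false → r ≡ false → B ≡ block l r a′ b′
  block-η {block _ _ _ _} p q refl refl with child-done p | child-done q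
  ... | refl , refl | refl , refl = refl

  -- If both children agree, then the opponent's block is `image v`, so the invariant must hold
  -- through a favourable verdict, and by `walk-same` nothing is stacked on it. At a leaf, the path
  -- plays the part of the children: only one block matches it.
  done-wins : ∀ k {p v} h₁ s₂ h₂ W → Done k p v → Ahead v s₂ h₂ W → Top true (walk k p (done v) h₁ s₂ h₂ W)
  done-wins zero {p} {v} h₁ s₂ h₂ W (e , _) ahead
    rewrite bad-leaf {image v} {p} e with bad (current s₂ h₂) p in eq | ahead
  ... | true  | _        = W , refl
  ... | false | inj₁ top = top
  ... | false | inj₂ ne  = ⊥-elim (ne (encB-injective {current s₂ h₂} (trans (good-leaf {current s₂ h₂} eq) (sym e))))
  done-wins (suc k) {p} {v} h₁ s₂ h₂ W ((dˡ , dʳ) , _) ahead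
    with compare (kˡ (current s₂ h₂) , a (current s₂ h₂)) (rest s₂ h₂) W (minimal k dˡ)
  ... | unlike c e ahead′ rewrite e = done-wins k h₁ _ _ (c ∷ W) dˡ ahead′
  ... | equal sˡ e rewrite e
    with compare (kʳ (current s₂ h₂) , b (current s₂ h₂)) (rest s₂ h₂) W (minimal k dʳ)
  ...   | unlike c e′ ahead′ rewrite e′ = done-wins k h₁ _ _ (c ∷ W) dʳ ahead′
  ...   | equal sʳ e′ rewrite e′ with ahead
  ...     | inj₂ ne = ⊥-elim (ne (block-η sˡ sʳ refl refl))
  ...     | inj₁ top rewrite sʳ | walk-same k (true ∷ p) (proj₂ (f v)) h₁ (rest s₂ h₂) W = top

  -- The second alternative is needed because filler bits can turn the verdict against a correct
  -- history. In that case the opponent has stopped with the same answer.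
  Concedes : BitString → State → List Block → List Block → Set
  Concedes W s₂ h₂ h₁ = Top true W ⊎ (∃[ j ] s₂ ≡ partial j) × extract h₂ ≡ extract h₁

  extract-left : ∀ h → kˡ (headBlock h) ≡ true → extract h ≡ extract (drop 1 h)
  extract-left []                     _ = refl
  extract-left (block true _ _ _ ∷ h) _ = refl

  extract-right : ∀ h → kʳ (headBlock h) ≡ true → extract h ≡ extract (drop 1 h)
  extract-right []                         _ = refl
  extract-right (block true true _ _ ∷ h)  _ = refl
  extract-right (block false true _ _ ∷ h) _ = refl

  extract-stop : ∀ h {a b} → headBlock h ≡ block false false a b → extract h ≡ just (toList a ++ toList b)
  extract-stop (_ ∷ _) refl = refl

  -- A finished node with this block would provide a preimage of the missed string.
  same-stop : ∀ {s h a b} → current s h ≡ block false false a b → Missed a b →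
              (∃[ j ] s ≡ partial j) × extract h ≡ just (toList a ++ toList b)
  same-stop {done v} e missed = ⊥-elim (missed v (cong₂ _,_ (cong Block.a e) (cong Block.b e)))
  same-stop {partial j} {h} e missed = (j , refl) , extract-stop h e

  -- Either the opponent disputes a finished child beside the path of unfinished nodes, and
  -- `done-wins` takes over, or the walk follows that path to the stop, where an opponent without a
  -- losing block has stopped too.
  partial-wins : ∀ k {p} h₁ j s₂ h₂ W → Partial k p h₁ → Concedes (walk k p (partial j) h₁ s₂ h₂ W) s₂ h₂ h₁
  partial-wins zero {p} h₁ j s₂ h₂ W (atLeaf {a = a} {b} e missed)
    rewrite bad-leaf {block false false a b} {p} e with bad (current s₂ h₂) p in eq
  ... | true  = inj₁ (W , refl)
  ... | false = inj₂ (same-stop {s₂} {h₂} (encB-injective {current s₂ h₂} (trans (good-leaf {current s₂ h₂} eq) (sym e))) missed)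
  partial-wins (suc k) h₁ j s₂ h₂ W (inLeft o) with partial-wins k _ _ (left (current s₂ h₂)) (rest s₂ h₂) _ o
  ... | inj₁ top = inj₁ top
  ... | inj₂ ((_ , l) , e) with s₂
  ...   | done _ with () ← l
  ...   | partial i = inj₂ ((i , refl) , trans (extract-left h₂ (child-partial l)) e)
  partial-wins (suc k) (_ ∷ h) j s₂ h₂ W (inRight {a = a′} d o)
    with compare (kˡ (current s₂ h₂) , a (current s₂ h₂)) (rest s₂ h₂) W (minimal k d)
  ... | unlike c e ahead rewrite e = inj₁ (done-wins k _ _ _ (c ∷ W) d ahead)
  ... | equal sˡ e rewrite e with partial-wins k _ _ (right (current s₂ h₂)) (rest s₂ h₂) _ o
  ...   | inj₁ top = inj₁ top
  ...   | inj₂ ((_ , l) , e′) with s₂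
  ...     | done _ with () ← l
  ...     | partial i = inj₂ ((i , refl) , trans (extract-right h₂ (child-partial l)) e′)
  partial-wins (suc k) (_ ∷ h) j s₂ h₂ W (here dˡ dʳ missed)
    with compare (kˡ (current s₂ h₂) , a (current s₂ h₂)) (rest s₂ h₂) W (minimal k dˡ)
  ... | unlike c e ahead rewrite e = inj₁ (done-wins k _ _ _ (c ∷ W) dˡ ahead)
  ... | equal sˡ e rewrite e
    with compare (kʳ (current s₂ h₂) , b (current s₂ h₂)) (rest s₂ h₂) W (minimal k dʳ)
  ...   | unlike c e′ ahead rewrite e′ = inj₁ (done-wins k _ _ _ (c ∷ W) dʳ ahead)
  ...   | equal sʳ _ = inj₂ (same-stop {s₂} {h₂} (block-η sˡ sʳ refl refl) missed)

  cmp-isPartial : ∀ s s′ → cmp (str s) (str s′) ≡ [] → isPartial s ≡ isPartial s′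
  cmp-isPartial (done _)  (done _)  _ = refl
  cmp-isPartial (partial _) (partial _) _ = refl

  -- Equal strings have equal tags, and for different strings the test is true from either side.
  left-swap : ∀ s s′ → isPartial s′ ∨ differ (cmp (str s′) (str s)) ≡ isPartial s ∨ differ (cmp (str s) (str s′))
  left-swap s s′ rewrite cmp-swap (str s) (str s′) | differ-not (cmp (str s) (str s′))
    with cmp (str s) (str s′) in e
  ... | []    = cong (_∨ false) (sym (cmp-isPartial s s′ e))
  ... | _ ∷ _ = trans (Boolₚ.∨-zeroʳ (isPartial s′)) (sym (Boolₚ.∨-zeroʳ (isPartial s)))

  -- By this symmetry, a correct history in the second player's hands is treated like one in the
  -- first player's.
  walk-swap : ∀ k p s₁ h₁ s₂ h₂ W →
              walk k p s₂ h₂ s₁ h₁ (map not W) ≡ map not (walk k p s₁ h₁ s₂ h₂ W)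
  walk-swap zero p s₁ h₁ s₂ h₂ W
    rewrite cmp-swap (bad (current s₁ h₁) p ∷ []) (bad (current s₂ h₂) p ∷ []) =
    sym (Listₚ.map-++ not (cmp (bad (current s₁ h₁) p ∷ []) (bad (current s₂ h₂) p ∷ [])) W)
  walk-swap (suc k) p s₁ h₁ s₂ h₂ W
    rewrite left-swap (left (current s₁ h₁)) (left (current s₂ h₂))
    with isPartial (left (current s₁ h₁)) ∨ differ (cmp (str (left (current s₁ h₁))) (str (left (current s₂ h₂))))
  ... | true
    rewrite cmp-swap (str (left (current s₁ h₁))) (str (left (current s₂ h₂)))
          | sym (Listₚ.map-++ not (cmp (str (left (current s₁ h₁))) (str (left (current s₂ h₂)))) W)
    = walk-swap k _ _ _ _ _ _
  ... | false
    rewrite cmp-swap (str (right (current s₁ h₁))) (str (right (current s₂ h₂)))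
          | sym (Listₚ.map-++ not (cmp (str (right (current s₁ h₁))) (str (right (current s₂ h₂)))) W)
    = walk-swap k _ _ _ _ _ _

  -- A correct history exists

  split-list : ∀ m (p : BitString) {l} → length p ≡ m + l → ∃[ a ] ∃[ q ] p ≡ toList {n = m} a ++ q × length q ≡ l
  split-list zero    p       e = [] , p , refl , e
  split-list (suc m) (x ∷ p) e with split-list m p (suc-injective e)
  ... | a , q , refl , e′ = x ∷ a , q , refl , e′

  -- A path has its last step in front, just as an encoded block has its last bit in front, so the
  -- test at a leaf is a plain comparison of two stacks.
  leaf-block : ∀ p → length p ≡ n + n → ∃[ a ] ∃[ b ] encB (block false false a b) ≡ leaf p
  leaf-block p e with split-list n (p ʳ++ []) (trans (length-ʳ++ p) (trans (+-identityʳ _) e))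
  ... | a , q , e₁ , lq with split-list n q (trans lq (sym (+-identityʳ n)))
  ...   | b , [] , refl , _ = a , b ,
    trans (cong (_ʳ++ false ∷ false ∷ [])
            (trans (cong (toList a ++_) (sym (++-identityʳ (toList b)))) (sym e₁)))
          (ʳ++-ʳ++ p)

  least-preimage : ∀ a b → (∃[ v ] f v ≡ (a , b) × Minimal v) ⊎ Missed a b
  least-preimage a b
    with least? n (λ v → ×-≡-dec (Vecₚ.≡-dec Boolₚ._≟_) (Vecₚ.≡-dec Boolₚ._≟_) (f v) (a , b))
  ... | inj₁ (v , e , min) = inj₁ (v , e , λ v′ e′ → min v′ (trans e′ e))
  ... | inj₂ none          = inj₂ none

  -- This is the postorder computation: left subtree, right subtree, then a least preimage.
  -- Histories have one block for each level, so that every proof can be cut into the same number of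
  -- blocks.
  explore : ∀ k p → k + length p ≡ n + n →
            (∃[ v ] Done k p v) ⊎ (∃[ h ] length h ≡ suc k × Partial k p h)
  explore zero p e with leaf-block p e
  ... | a , b , enc with least-preimage a b
  ...   | inj₁ (v , fv , min) = inj₁ (v , trans (cong (λ c → encB (block false false (proj₁ c) (proj₂ c))) fv) enc , min)
  ...   | inj₂ missed         = inj₂ (_ , refl , atLeaf {h = []} enc missed)
  explore (suc k) p e with explore k (false ∷ p) (trans (+-suc k _) e)
  ... | inj₂ (h , l , o) = inj₂ (_ , cong suc l , inLeft {l = false} {Vec.replicate n false} {Vec.replicate n false} o)
  ... | inj₁ (a , da) with explore k (true ∷ p) (trans (+-suc k _) e)
  ...   | inj₂ (h , l , o) = inj₂ (_ , cong suc l , inRight {b = Vec.replicate n false} da o)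
  ...   | inj₁ (b , db) with least-preimage a b
  ...     | inj₁ (v , refl , min) = inj₁ (v , (da , db) , min)
  -- The computation stops above the leaves, so filler blocks supply the remaining levels.
  ...     | inj₂ missed = inj₂ (_ , cong suc (Listₚ.length-replicate (suc k)) ,
                                here {h = replicate (suc k) (headBlock [])} da db missed)

  -- `q ʳ++ p` is the path reached from `p` by following `q` downwards. From the root this reaches
  -- every string, so a finished root would make `f` onto.
  done-leaves : ∀ k {p v} → Done k p v → ∀ q → length q ≡ k → ∃[ v′ ] encB (image v′) ≡ leaf (q ʳ++ p)
  done-leaves zero    {v = v} (e , _) [] _ = v , e
  done-leaves (suc k) ((dˡ , dʳ) , _) (false ∷ q) e = done-leaves k dˡ q (suc-injective e)
  done-leaves (suc k) ((dˡ , dʳ) , _) (true ∷ q)  e = done-leaves k dʳ q (suc-injective e)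

  partial-missed : ∀ k {p h} → Partial k p h → ∃[ a ] ∃[ b ] extract h ≡ just (toList a ++ toList b) × Missed a b
  partial-missed _ (atLeaf {a = a} {b} _ m)  = a , b , refl , m
  partial-missed _ (inLeft o)    = partial-missed _ o
  partial-missed _ (inRight _ o) = partial-missed _ o
  partial-missed _ (here {a = a} {b} _ _ m)  = a , b , refl , m

module _ {m : ℕ} (f : Vec Bool (suc m) → Vec Bool (suc m) × Vec Bool (suc m)) where
  open Korten f

  private
    n : ℕ
    n = suc m

  root-not-done : ∀ {v} → ¬ Done (n + n) [] v
  root-not-done d = doubling-not-onto m (λ x → proj₁ (f x) Vec.++ proj₂ (f x)) onto
    where
    onto : ∀ y → ∃[ x ] proj₁ (f x) Vec.++ proj₂ (f x) ≡ y
    onto y with done-leaves (n + n) d (toList y) (Vecₚ.length-toList y)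
    ... | x , e = x , toList-injective _ _
      (trans (Vecₚ.toList-++ (proj₁ (f x)) (proj₂ (f x)))
        (∷-injectiveʳ (∷-injectiveʳ
          (trans (sym (cong (λ l → false ∷ false ∷ l) (++-identityʳ _)))
          (trans (sym (ʳ++-ʳ++ (toList (proj₁ (f x)) ++ toList (proj₂ (f x)))))
          (trans (cong (_ʳ++ []) e) (unleaf (toList y))))))))
      where
      unleaf : ∀ q → leaf (q ʳ++ []) ʳ++ [] ≡ false ∷ false ∷ q
      unleaf q = trans (Listₚ.++-ʳ++ (q ʳ++ [])) (cong (λ l → false ∷ false ∷ l) (trans (ʳ++-ʳ++ q) (++-identityʳ q)))

  history : ∃[ h ] length h ≡ suc (n + n) × Partial (n + n) [] h
  history with explore (n + n) [] (+-identityʳ _)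
  ... | inj₁ (_ , d) = ⊥-elim (root-not-done d)
  ... | inj₂ h       = h

-- Stack programs on part of the store

rename : ∀ {j k} → Vec (Fin k) j → Prog j → Prog k
rename ρ skip           = skip
rename ρ (push i b)     = push (lookup ρ i) b
rename ρ (pop i)        = pop (lookup ρ i)
rename ρ (c ⨾ d)        = rename ρ c ⨾ rename ρ d
rename ρ (case i e f t) = case (lookup ρ i) (rename ρ e) (rename ρ f) (rename ρ t)
rename ρ (for c)        = for (rename ρ c)

Distinct : ∀ {j k} → Vec (Fin k) j → Set
Distinct ρ = ∀ i i′ → lookup ρ i ≡ lookup ρ i′ → i ≡ i′

distinct? : ∀ {j k} (ρ : Vec (Fin k) j) → Dec (Distinct ρ)
distinct? ρ = Finₚ.all? λ i → Finₚ.all? λ i′ → (lookup ρ i Finₚ.≟ lookup ρ i′) →-dec (i Finₚ.≟ i′)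

gather : ∀ {j k} → Vec (Fin k) j → Store k → Store j
gather ρ σ = Vec.map (lookup σ) ρ

scatter : ∀ {j k} → Vec (Fin k) j → Store j → Store k → Store k
scatter []      []      σ = σ
scatter (r ∷ ρ) (x ∷ τ) σ = scatter ρ τ σ [ r ]≔ x

distinct-tail : ∀ {j k} {r} {ρ : Vec (Fin k) j} → Distinct (r ∷ ρ) → Distinct ρ
distinct-tail d i i′ e = Finₚ.suc-injective (d (suc i) (suc i′) e)

lookup-scatter : ∀ {j k} (ρ : Vec (Fin k) j) → Distinct ρ → ∀ τ σ i →
                 lookup (scatter ρ τ σ) (lookup ρ i) ≡ lookup τ i
lookup-scatter (r ∷ ρ) d (x ∷ τ) σ zero    = lookup∘update r (scatter ρ τ σ) x
lookup-scatter (r ∷ ρ) d (x ∷ τ) σ (suc i) =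
  trans (lookup∘update′ (λ e → Finₚ.0≢1+n (sym (d (suc i) zero e))) (scatter ρ τ σ) x)
        (lookup-scatter ρ (distinct-tail d) τ σ i)

update-scatter : ∀ {j k} (ρ : Vec (Fin k) j) → Distinct ρ → ∀ τ σ i f →
                 scatter ρ τ σ [ lookup ρ i ]%= f ≡ scatter ρ (τ [ i ]%= f) σ
update-scatter (r ∷ ρ) d (x ∷ τ) σ zero    f = updateAt-updateAt r (scatter ρ τ σ)
update-scatter (r ∷ ρ) d (x ∷ τ) σ (suc i) f =
  trans (updateAt-commutes (lookup ρ i) r (λ e → Finₚ.0≢1+n (sym (d (suc i) zero e))) (scatter ρ τ σ))
        (cong (_[ r ]≔ x) (update-scatter ρ (distinct-tail d) τ σ i f))

scatter-gather : ∀ {j k} (ρ : Vec (Fin k) j) σ → scatter ρ (gather ρ σ) σ ≡ σ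
scatter-gather []      σ = refl
scatter-gather (r ∷ ρ) σ = trans (cong (_[ r ]≔ lookup σ r) (scatter-gather ρ σ)) ([]≔-lookup σ r)

onTop-cong : ∀ {A B : Set} (g : A → B) w {e f t : A} → onTop w (g e) (g f) (g t) ≡ g (onTop w e f t)
onTop-cong g []          = refl
onTop-cong g (false ∷ _) = refl
onTop-cong g (true ∷ _)  = refl

-- Elementary programs: moving, copying, reading and comparing stacks

moveTop : Prog 2
moveTop = case 0F skip (pop 0F ⨾ push 1F false) (pop 0F ⨾ push 1F true)

mv : Prog 2
mv = for moveTop

dupTop : Prog 3
dupTop = case 0F skip (pop 0F ⨾ push 1F false ⨾ push 2F false) (pop 0F ⨾ push 1F true ⨾ push 2F true)

clear : Prog 1
clear = for (pop 0F)

ʳ++-[]-length : ∀ (xs : BitString) → length (xs ʳ++ []) ≡ length xs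
ʳ++-[]-length xs = trans (length-ʳ++ xs) (+-identityʳ _)

unreverse : ∀ (xs : BitString) ys → (xs ʳ++ []) ʳ++ ys ≡ xs ++ ys
unreverse xs ys = ʳ++-ʳ++ xs

unreverse-[] : ∀ (xs : BitString) → (xs ʳ++ []) ʳ++ [] ≡ xs
unreverse-[] xs = trans (ʳ++-ʳ++ xs) (++-identityʳ xs)

-- Registers: source, scratch, target.
copy : Prog 3
copy = rename (0F ∷ 1F ∷ []) mv ⨾ for (rename (1F ∷ 0F ∷ 2F ∷ []) dupTop)

iter-+ : ∀ {A : Set} m n (f : A → A) a → iter (m + n) f a ≡ iter n f (iter m f a)
iter-+ zero    n f a = refl
iter-+ (suc m) n f a = iter-+ m n f (f a)

iter-* : ∀ {A : Set} m n (f : A → A) a → iter m (iter n f) a ≡ iter (m * n) f a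
iter-* zero    n f a = refl
iter-* (suc m) n f a = trans (iter-* m n f (iter n f a)) (sym (iter-+ n (m * n) f a))

-- The proofs have length `N * N`, which takes two nested loops.
copyLong : Prog 3
copyLong = rename (0F ∷ 1F ∷ []) (for (for moveTop)) ⨾ rename (1F ∷ 0F ∷ 2F ∷ []) (for (for dupTop))

trues : ℕ → BitString
trues n = replicate n true

-- Registers: counter, its copy, source, target.
countedMove : Prog 4
countedMove = for (case 0F skip skip (pop 0F ⨾ push 1F true ⨾ rename (2F ∷ 3F ∷ []) moveTop))

-- Registers: counter, scratch, source, two targets.
readBlock : Prog 5
readBlock = rename (0F ∷ 1F ∷ 2F ∷ 4F ∷ []) countedMove
          ⨾ rename (1F ∷ 0F ∷ 2F ∷ 3F ∷ []) countedMove
          ⨾ rename (2F ∷ 3F ∷ []) moveTop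
          ⨾ rename (2F ∷ 4F ∷ []) moveTop

private
  both : Bool → Bool → Prog 5 → Prog 5
  both x y c = pop 0F ⨾ pop 1F ⨾ push 2F x ⨾ push 3F y ⨾ c

  -- Only the first difference is recorded; later ones find the register occupied.
  note : Bool → Prog 5
  note y = case 4F (push 4F y) skip skip

  cmpBody : Prog 5
  cmpBody = case 0F skip
    (case 1F skip (both false false skip) (both false true (note true)))
    (case 1F skip (both true false (note false)) (both true true skip))

-- Registers: the two strings, two scratch stacks, result.
cmpProg : Prog 5
cmpProg = for cmpBody ⨾ rename (2F ∷ 0F ∷ []) mv ⨾ rename (3F ∷ 1F ∷ []) mv

module Library (N : ℕ) where

  -- This is the frame rule: a subprogram is verified on its own few registers and then run inside a
  -- larger store. Distinctness is what makes updates commute with `scatter`.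
  run-rename : ∀ {j k} (ρ : Vec (Fin k) j) → Distinct ρ → ∀ c τ σ →
               run N (rename ρ c) (scatter ρ τ σ) ≡ scatter ρ (run N c τ) σ
  run-rename ρ d skip       τ σ = refl
  run-rename ρ d (push i b) τ σ = update-scatter ρ d τ σ i (b ∷_)
  run-rename ρ d (pop i)    τ σ = update-scatter ρ d τ σ i (drop 1)
  run-rename ρ d (c ⨾ c′)   τ σ =
    trans (cong (run N (rename ρ c′)) (run-rename ρ d c τ σ)) (run-rename ρ d c′ (run N c τ) σ)
  run-rename ρ d (case i e f t) τ σ
    rewrite lookup-scatter ρ d τ σ i | run-rename ρ d e τ σ | run-rename ρ d f τ σ | run-rename ρ d t τ σ =
    onTop-cong (λ υ → scatter ρ υ σ) (lookup τ i)
  run-rename ρ d (for c) τ σ = loop N τ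
    where
    loop : ∀ r τ → iter r (run N (rename ρ c)) (scatter ρ τ σ) ≡ scatter ρ (iter r (run N c) τ) σ
    loop zero    τ = refl
    loop (suc r) τ = trans (cong (iter r (run N (rename ρ c))) (run-rename ρ d c τ σ)) (loop r (run N c τ))

  -- The record keeps program and stores visible to unification, where a bare equation would let
  -- `run` unfold.
  record Runs {k : ℕ} (c : Prog k) (σ τ : Store k) : Set where
    constructor runs
    field result : run N c σ ≡ τ
  open Runs public

  infixr 4 _⟫_

  _⟫_ : ∀ {k} {c d : Prog k} {σ τ υ} → Runs c σ τ → Runs d τ υ → Runs (c ⨾ d) σ υ
  _⟫_ {d = d} (runs p) (runs q) = runs (trans (cong (run N d) p) q)

  to : ∀ {k} {c : Prog k} {σ τ τ′} → Runs c σ τ → τ ≡ τ′ → Runs c σ τ′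
  to p refl = p

  -- The register lists are concrete, so `distinct?` evaluates and the implicit argument is found by
  -- computation.
  call : ∀ {j k} (ρ : Vec (Fin k) j) {d : True (distinct? ρ)} {c σ τ τ′ σ′} → Runs c τ τ′ →
         gather ρ σ ≡ τ → scatter ρ τ′ σ ≡ σ′ → Runs (rename ρ c) σ σ′
  call ρ {d} {c} {σ} (runs e) refl refl = runs
    (trans (cong (run N (rename ρ c)) (sym (scatter-gather ρ σ)))
    (trans (run-rename ρ (toWitness d) c (gather ρ σ) σ) (cong (λ υ → scatter ρ υ σ) e)))

  case-[] : ∀ {k i} {e f t : Prog k} {σ τ} → lookup σ i ≡ [] → Runs e σ τ → Runs (case i e f t) σ τ
  case-[] p (runs q) = runs (trans (onTop-[] p) q)
    where
    onTop-[] : ∀ {A : Set} {w} {e f t : A} → w ≡ [] → onTop w e f t ≡ e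
    onTop-[] refl = refl

  case-false : ∀ {k i} {e f t : Prog k} {σ τ w} → lookup σ i ≡ false ∷ w → Runs f σ τ → Runs (case i e f t) σ τ
  case-false p (runs q) = runs (trans (onTop-false p) q)
    where
    onTop-false : ∀ {A : Set} {v w} {e f t : A} → v ≡ false ∷ w → onTop v e f t ≡ f
    onTop-false refl = refl

  case-true : ∀ {k i} {e f t : Prog k} {σ τ w} → lookup σ i ≡ true ∷ w → Runs t σ τ → Runs (case i e f t) σ τ
  case-true p (runs q) = runs (trans (onTop-true p) q)
    where
    onTop-true : ∀ {A : Set} {v w} {e f t : A} → v ≡ true ∷ w → onTop v e f t ≡ t
    onTop-true refl = refl

  -- Moving and copying

  iter-moveTop : ∀ r xs ys → length xs ≤ r →
                 iter r (run N moveTop) (xs ∷ ys ∷ []) ≡ [] ∷ (xs ʳ++ ys) ∷ []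
  iter-moveTop zero    []           ys _       = refl
  iter-moveTop (suc r) []           ys _       = iter-moveTop r [] ys z≤n
  iter-moveTop (suc r) (false ∷ xs) ys (s≤s h) = iter-moveTop r xs (false ∷ ys) h
  iter-moveTop (suc r) (true ∷ xs)  ys (s≤s h) = iter-moveTop r xs (true ∷ ys) h

  mv-runs : ∀ {xs} ys → length xs ≤ N → Runs mv (xs ∷ ys ∷ []) ([] ∷ (xs ʳ++ ys) ∷ [])
  mv-runs ys h = runs (iter-moveTop N _ ys h)

  moveTop-runs : ∀ x xs ys → Runs moveTop ((x ∷ xs) ∷ ys ∷ []) (xs ∷ (x ∷ ys) ∷ [])
  moveTop-runs false xs ys = runs refl
  moveTop-runs true  xs ys = runs refl

  iter-dupTop : ∀ r xs ys zs → length xs ≤ r →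
                iter r (run N dupTop) (xs ∷ ys ∷ zs ∷ []) ≡ [] ∷ (xs ʳ++ ys) ∷ (xs ʳ++ zs) ∷ []
  iter-dupTop zero    []           ys zs _       = refl
  iter-dupTop (suc r) []           ys zs _       = iter-dupTop r [] ys zs z≤n
  iter-dupTop (suc r) (false ∷ xs) ys zs (s≤s h) = iter-dupTop r xs (false ∷ ys) (false ∷ zs) h
  iter-dupTop (suc r) (true ∷ xs)  ys zs (s≤s h) = iter-dupTop r xs (true ∷ ys) (true ∷ zs) h

  clear-runs : ∀ {xs} → length xs ≤ N → Runs clear (xs ∷ []) ([] ∷ [])
  clear-runs {xs} h = runs (loop N xs h)
    where
    loop : ∀ r xs → length xs ≤ r → iter r (run N (pop 0F)) (xs ∷ []) ≡ [] ∷ []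
    loop zero    []       _       = refl
    loop (suc r) []       _       = loop r [] z≤n
    loop (suc r) (_ ∷ xs) (s≤s h) = loop r xs h

  copy-runs : ∀ {xs} → length xs ≤ N → Runs copy (xs ∷ [] ∷ [] ∷ []) (xs ∷ [] ∷ xs ∷ [])
  copy-runs {xs} h =
    to (call (0F ∷ 1F ∷ []) (mv-runs [] h) refl refl
        ⟫ call (1F ∷ 0F ∷ 2F ∷ []) {c = for dupTop}
            (runs (iter-dupTop N (xs ʳ++ []) [] [] (subst (_≤ N) (sym (ʳ++-[]-length xs)) h))) refl refl)
       (cong (λ l → l ∷ [] ∷ l ∷ []) (unreverse-[] xs))

  copyLong-runs : ∀ {xs} → length xs ≤ N * N → Runs copyLong (xs ∷ [] ∷ [] ∷ []) (xs ∷ [] ∷ xs ∷ [])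
  copyLong-runs {xs} h =
    to (call (0F ∷ 1F ∷ []) {c = for (for moveTop)}
          (runs (trans (iter-* N N (run N moveTop) (xs ∷ [] ∷ [])) (iter-moveTop (N * N) xs [] h))) refl refl
        ⟫ call (1F ∷ 0F ∷ 2F ∷ []) {c = for (for dupTop)}
            (runs (trans (iter-* N N (run N dupTop) ((xs ʳ++ []) ∷ [] ∷ [] ∷ []))
              (iter-dupTop (N * N) (xs ʳ++ []) [] [] (subst (_≤ N * N) (sym (ʳ++-[]-length xs)) h)))) refl refl)
       (cong (λ l → l ∷ [] ∷ l ∷ []) (unreverse-[] xs))

  countedMove-runs : ∀ {xs ys zs} n → length xs ≡ n → n ≤ N →
                     Runs countedMove (trues n ∷ [] ∷ (xs ++ ys) ∷ zs ∷ []) ([] ∷ trues n ∷ ys ∷ (xs ʳ++ zs) ∷ [])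
  countedMove-runs n lxs h =
    runs (trans (loop N n 0 _ lxs h) (cong (λ m → [] ∷ trues m ∷ _ ∷ _ ∷ []) (+-identityʳ n)))
    where
    body = case 0F skip skip (pop 0F ⨾ push 1F true ⨾ rename (2F ∷ 3F ∷ []) moveTop)
    loop : ∀ r n m xs {ys zs} → length xs ≡ n → n ≤ r →
           iter r (run N body) (trues n ∷ trues m ∷ (xs ++ ys) ∷ zs ∷ []) ≡ [] ∷ trues (n + m) ∷ ys ∷ (xs ʳ++ zs) ∷ []
    loop zero    zero    m []       _   _       = refl
    loop (suc r) zero    m []       _   _       = loop r zero m [] refl z≤n
    loop (suc r) (suc n) m (false ∷ xs) {ys} {zs} e (s≤s h) =
      trans (loop r n (suc m) xs (suc-injective e) h)
            (cong (λ k → [] ∷ trues k ∷ ys ∷ (xs ʳ++ false ∷ zs) ∷ []) (+-suc n m))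
    loop (suc r) (suc n) m (true ∷ xs) {ys} {zs} e (s≤s h) =
      trans (loop r n (suc m) xs (suc-injective e) h)
            (cong (λ k → [] ∷ trues k ∷ ys ∷ (xs ʳ++ true ∷ zs) ∷ []) (+-suc n m))

  -- In a reversed block the bits of the right half come off first. Each `countedMove` restores
  -- their order, the second one running the counter back. The kinds come off last and land on top
  -- as the tags of `str`.
  readBlock-runs : ∀ {n} (xs ys : BitString) k l zs → length xs ≡ n → length ys ≡ n → n ≤ N →
    Runs readBlock (trues n ∷ [] ∷ ((xs ++ ys) ʳ++ k ∷ l ∷ zs) ∷ [] ∷ [] ∷ [])
                   (trues n ∷ [] ∷ zs ∷ (k ∷ xs) ∷ (l ∷ ys) ∷ [])
  readBlock-runs {n} xs ys k l zs lx ly h =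
    subst (λ w → Runs readBlock (trues n ∷ [] ∷ w ∷ [] ∷ [] ∷ []) (trues n ∷ [] ∷ zs ∷ (k ∷ xs) ∷ (l ∷ ys) ∷ []))
      (sym layout)
      (to (call (0F ∷ 1F ∷ 2F ∷ 4F ∷ []) (countedMove-runs {ys ʳ++ []} n (trans (ʳ++-[]-length ys) ly) h) refl refl
           ⟫ call (1F ∷ 0F ∷ 2F ∷ 3F ∷ []) (countedMove-runs {xs ʳ++ []} n (trans (ʳ++-[]-length xs) lx) h) refl refl
           ⟫ call (2F ∷ 3F ∷ []) (moveTop-runs k (l ∷ zs) _) refl refl
           ⟫ call (2F ∷ 4F ∷ []) (moveTop-runs l zs _) refl refl)
          (cong₂ (λ u v → trues n ∷ [] ∷ zs ∷ (k ∷ u) ∷ (l ∷ v) ∷ []) (unreverse-[] xs) (unreverse-[] ys)))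
    where
    ʳ++-split : ∀ (xs ys : BitString) → xs ʳ++ ys ≡ (xs ʳ++ []) ++ ys
    ʳ++-split xs ys = trans (cong (_ʳ++ ys) (sym (unreverse-[] xs)))
                        (trans (ʳ++-ʳ++ (xs ʳ++ [])) refl)
    layout : (xs ++ ys) ʳ++ k ∷ l ∷ zs ≡ (ys ʳ++ []) ++ (xs ʳ++ []) ++ k ∷ l ∷ zs
    layout = trans (++-ʳ++ xs) (trans (ʳ++-split ys _) (cong ((ys ʳ++ []) ++_) (ʳ++-split xs _)))

  -- Comparison

  -- The tail `zs` allows a path to be compared with the top block of a history in place.
  cmpProg-runs : ∀ {xs ys zs} → length xs ≡ length ys → length xs ≤ N →
    Runs cmpProg (xs ∷ (ys ++ zs) ∷ [] ∷ [] ∷ [] ∷ []) (xs ∷ (ys ++ zs) ∷ [] ∷ [] ∷ cmp xs ys ∷ [])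
  cmpProg-runs {xs} {ys} {zs} e h =
    to (runs (loop N xs ys [] [] [] e h)
        ⟫ call (2F ∷ 0F ∷ []) (mv-runs [] (subst (_≤ N) (sym (ʳ++-[]-length xs)) h)) refl refl
        ⟫ call (3F ∷ 1F ∷ []) (mv-runs zs (subst (_≤ N) (trans e (sym (ʳ++-[]-length ys))) h)) refl refl)
       (cong₂ (λ u v → u ∷ v ∷ [] ∷ [] ∷ cmp xs ys ∷ []) (unreverse-[] xs) (unreverse ys zs))
    where
    loop : ∀ r xs ys p q c → length xs ≡ length ys → length xs ≤ r →
           iter r (run N cmpBody) (xs ∷ (ys ++ zs) ∷ p ∷ q ∷ c ∷ [])
           ≡ [] ∷ zs ∷ (xs ʳ++ p) ∷ (ys ʳ++ q) ∷ onTop c (cmp xs ys) c c ∷ []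
    loop zero    []           []           p q []          _ _ = refl
    loop zero    []           []           p q (false ∷ c) _ _ = refl
    loop zero    []           []           p q (true ∷ c)  _ _ = refl
    loop (suc r) []           []           p q c e h       = loop r [] [] p q c refl z≤n
    loop (suc r) (false ∷ xs) (false ∷ ys) p q c e (s≤s h) = loop r xs ys _ _ c (suc-injective e) h
    loop (suc r) (true ∷ xs)  (true ∷ ys)  p q c e (s≤s h) = loop r xs ys _ _ c (suc-injective e) h
    loop (suc r) (false ∷ xs) (true ∷ ys)  p q []          e (s≤s h) = loop r xs ys _ _ (true ∷ []) (suc-injective e) h
    loop (suc r) (false ∷ xs) (true ∷ ys)  p q (false ∷ c) e (s≤s h) = loop r xs ys _ _ (false ∷ c) (suc-injective e) h
    loop (suc r) (false ∷ xs) (true ∷ ys)  p q (true ∷ c)  e (s≤s h) = loop r xs ys _ _ (true ∷ c) (suc-injective e) h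
    loop (suc r) (true ∷ xs)  (false ∷ ys) p q []          e (s≤s h) = loop r xs ys _ _ (false ∷ []) (suc-injective e) h
    loop (suc r) (true ∷ xs)  (false ∷ ys) p q (false ∷ c) e (s≤s h) = loop r xs ys _ _ (false ∷ c) (suc-injective e) h
    loop (suc r) (true ∷ xs)  (false ∷ ys) p q (true ∷ c)  e (s≤s h) = loop r xs ys _ _ (true ∷ c) (suc-injective e) h

-- Circuit evaluation

-- Registers: code, wires, scratch, target.
readWire : Prog 4
readWire = for (case 0F skip skip (pop 0F ⨾ rename (1F ∷ 2F ∷ []) moveTop))
         ⨾ pop 0F
         ⨾ case 1F skip (push 3F false) (push 3F true)
         ⨾ rename (2F ∷ 1F ∷ []) mv

conjoin disjoin negate : Prog 4
conjoin = case 3F skip (pop 3F ⨾ pop 3F ⨾ push 1F false)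
                       (pop 3F ⨾ case 3F skip (pop 3F ⨾ push 1F false) (pop 3F ⨾ push 1F true))
disjoin = case 3F skip (pop 3F ⨾ case 3F skip (pop 3F ⨾ push 1F false) (pop 3F ⨾ push 1F true))
                       (pop 3F ⨾ pop 3F ⨾ push 1F true)
negate  = case 3F skip (pop 3F ⨾ push 1F true) (pop 3F ⨾ push 1F false)

-- Does nothing at the end marker 11.
gateProg : Prog 4
gateProg = case 0F skip
  (pop 0F ⨾ case 0F skip (pop 0F ⨾ readWire ⨾ readWire ⨾ conjoin)
                         (pop 0F ⨾ readWire ⨾ readWire ⨾ disjoin))
  (pop 0F ⨾ case 0F skip (pop 0F ⨾ readWire ⨾ negate) (push 0F true))

gatesProg : Prog 4
gatesProg = for gateProg ⨾ pop 0F ⨾ pop 0F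

outputsProg : Prog 4
outputsProg = for (case 0F skip readWire readWire)

-- Registers: code, wires, two scratch stacks, target.
evalProg : Prog 5
evalProg = rename (0F ∷ 1F ∷ 2F ∷ 3F ∷ []) gatesProg ⨾ rename (0F ∷ 1F ∷ 2F ∷ 4F ∷ []) outputsProg

toList-split : ∀ {w} (v : Vec Bool w) i → ∃[ xs ] ∃[ ys ] toList v ≡ xs ++ lookup v i ∷ ys × length xs ≡ toℕ i
toList-split (x ∷ v) zero    = [] , toList v , refl , refl
toList-split (x ∷ v) (suc i) with toList-split v i
... | xs , ys , e , l = x ∷ xs , ys , cong (x ∷_) e , cong suc l

toℕ≤length-encodeWire : ∀ {w} (i : Fin w) rest → toℕ i ≤ length (encodeWire i ++ rest)
toℕ≤length-encodeWire zero    rest = z≤n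
toℕ≤length-encodeWire (suc i) rest = s≤s (toℕ≤length-encodeWire i rest)

encodeWire-suffix : ∀ {w} (i : Fin w) rest → length rest ≤ length (encodeWire i ++ rest)
encodeWire-suffix zero    rest = n≤1+n _
encodeWire-suffix (suc i) rest = m≤n⇒m≤1+n (encodeWire-suffix i rest)

encodeGate-suffix : ∀ {w} (g : Gate w) rest → length rest < length (encodeGate g ++ rest)
encodeGate-suffix (and i j) rest rewrite ++-assoc (encodeWire i) (encodeWire j) rest =
  s≤s (m≤n⇒m≤1+n (≤-trans (encodeWire-suffix j rest) (encodeWire-suffix i _)))
encodeGate-suffix (or i j)  rest rewrite ++-assoc (encodeWire i) (encodeWire j) rest =
  s≤s (m≤n⇒m≤1+n (≤-trans (encodeWire-suffix j rest) (encodeWire-suffix i _)))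
encodeGate-suffix (neg i)   rest = s≤s (m≤n⇒m≤1+n (encodeWire-suffix i rest))

#gates : ∀ {w w′} → Gates w w′ → ℕ
#gates []       = 0
#gates (_ ∷ gs) = suc (#gates gs)

#gates-encode : ∀ {w w′} (gs : Gates w w′) rest → 2 + #gates gs + length rest ≤ length (encodeGates gs ++ rest)
#gates-encode []       rest = ≤-refl
#gates-encode (g ∷ gs) rest rewrite ++-assoc (encodeGate g) (encodeGates gs) rest =
  ≤-trans (s≤s (#gates-encode gs rest)) (encodeGate-suffix g _)

#gates-wires : ∀ {w w′} (gs : Gates w w′) → #gates gs + w ≡ w′
#gates-wires []       = refl
#gates-wires (g ∷ gs) = trans (sym (+-suc (#gates gs) _)) (#gates-wires gs)

encodeOutputs-length : ∀ {w m} (os : Vec (Fin w) m) → m ≤ length (encodeOutputs os)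
encodeOutputs-length []       = z≤n
encodeOutputs-length (o ∷ os) = ≤-trans (s≤s (encodeOutputs-length os)) (grow o)
  where
  grow : ∀ {w} (o : Fin w) {rest} → suc (length rest) ≤ length (encodeWire o ++ rest)
  grow zero    = ≤-refl
  grow (suc o) = m≤n⇒m≤1+n (grow o)

module Circuits (N : ℕ) where
  open Library N

  readWire-runs : ∀ {w} (v : Vec Bool w) i {rest bs} → toℕ i ≤ N →
    Runs readWire ((encodeWire i ++ rest) ∷ toList v ∷ [] ∷ bs ∷ []) (rest ∷ toList v ∷ [] ∷ (lookup v i ∷ bs) ∷ [])
  readWire-runs v i {rest} {bs} h with toList-split v i
  ... | xs , ys , e , l rewrite e =
    to (runs (loop N (toℕ i) xs [] l h)
        ⟫ runs refl
        ⟫ record-bit (lookup v i)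
        ⟫ call (2F ∷ 1F ∷ []) (mv-runs (lookup v i ∷ ys) (subst (_≤ N) (sym (trans (ʳ++-[]-length xs) l)) h)) refl refl)
       (cong (λ u → rest ∷ u ∷ [] ∷ (lookup v i ∷ bs) ∷ []) (unreverse xs _))
    where
    body = case 0F skip skip (pop 0F ⨾ rename (1F ∷ 2F ∷ []) moveTop)
    loop : ∀ r j xs zs → length xs ≡ j → j ≤ r →
      iter r (run N body) (((replicate j true ++ false ∷ []) ++ rest) ∷ (xs ++ lookup v i ∷ ys) ∷ zs ∷ bs ∷ [])
      ≡ (false ∷ rest) ∷ (lookup v i ∷ ys) ∷ (xs ʳ++ zs) ∷ bs ∷ []
    loop zero    zero    []           zs _ _       = refl
    loop (suc r) zero    []           zs _ _       = loop r zero [] zs refl z≤n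
    loop (suc r) (suc j) (false ∷ xs) zs e (s≤s h) = loop r j xs (false ∷ zs) (suc-injective e) h
    loop (suc r) (suc j) (true ∷ xs)  zs e (s≤s h) = loop r j xs (true ∷ zs) (suc-injective e) h
    record-bit : ∀ b {zs} → Runs (case 1F skip (push 3F false) (push 3F true))
                        (rest ∷ (b ∷ ys) ∷ zs ∷ bs ∷ []) (rest ∷ (b ∷ ys) ∷ zs ∷ (b ∷ bs) ∷ [])
    record-bit false = runs refl
    record-bit true  = runs refl

  conjoin-runs : ∀ x y {c ws z bs} → Runs conjoin (c ∷ ws ∷ z ∷ (y ∷ x ∷ bs) ∷ []) (c ∷ ((x ∧ y) ∷ ws) ∷ z ∷ bs ∷ [])
  conjoin-runs false false = runs refl
  conjoin-runs false true  = runs refl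
  conjoin-runs true  false = runs refl
  conjoin-runs true  true  = runs refl

  disjoin-runs : ∀ x y {c ws z bs} → Runs disjoin (c ∷ ws ∷ z ∷ (y ∷ x ∷ bs) ∷ []) (c ∷ ((x ∨ y) ∷ ws) ∷ z ∷ bs ∷ [])
  disjoin-runs false false = runs refl
  disjoin-runs false true  = runs refl
  disjoin-runs true  false = runs refl
  disjoin-runs true  true  = runs refl

  negate-runs : ∀ x {c ws z bs} → Runs negate (c ∷ ws ∷ z ∷ (x ∷ bs) ∷ []) (c ∷ (not x ∷ ws) ∷ z ∷ bs ∷ [])
  negate-runs false = runs refl
  negate-runs true  = runs refl

  gate-runs : ∀ {w} (g : Gate w) (v : Vec Bool w) {rest} → length (encodeGate g ++ rest) ≤ N →
    Runs gateProg ((encodeGate g ++ rest) ∷ toList v ∷ [] ∷ [] ∷ []) (rest ∷ toList (evalGate g v ∷ v) ∷ [] ∷ [] ∷ [])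
  gate-runs (and i j) v {rest} h rewrite ++-assoc (encodeWire i) (encodeWire j) rest =
    case-false refl (runs refl ⟫ case-false refl (runs refl
      ⟫ readWire-runs v i (≤-trans (toℕ≤length-encodeWire i _) (m+n≤o⇒n≤o 2 h))
      ⟫ readWire-runs v j (≤-trans (toℕ≤length-encodeWire j _) (≤-trans (encodeWire-suffix i _) (m+n≤o⇒n≤o 2 h)))
      ⟫ conjoin-runs (lookup v i) (lookup v j)))
  gate-runs (or i j) v {rest} h rewrite ++-assoc (encodeWire i) (encodeWire j) rest =
    case-false refl (runs refl ⟫ case-true refl (runs refl
      ⟫ readWire-runs v i (≤-trans (toℕ≤length-encodeWire i _) (m+n≤o⇒n≤o 2 h))
      ⟫ readWire-runs v j (≤-trans (toℕ≤length-encodeWire j _) (≤-trans (encodeWire-suffix i _) (m+n≤o⇒n≤o 2 h)))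
      ⟫ disjoin-runs (lookup v i) (lookup v j)))
  gate-runs (neg i) v {rest} h =
    case-true refl (runs refl ⟫ case-false refl (runs refl
      ⟫ readWire-runs v i (≤-trans (toℕ≤length-encodeWire i _) (m+n≤o⇒n≤o 2 h))
      ⟫ negate-runs (lookup v i)))

  gates-runs : ∀ {w w′} (gs : Gates w w′) (v : Vec Bool w) {rest} → length (encodeGates gs ++ rest) ≤ N →
    Runs gatesProg ((encodeGates gs ++ rest) ∷ toList v ∷ [] ∷ [] ∷ []) (rest ∷ toList (evalGates gs v) ∷ [] ∷ [] ∷ [])
  gates-runs gs v {rest} h =
    runs (loop N gs v h (≤-trans (≤-trans (m≤m+n (#gates gs) _) (≤-trans (m≤n+m _ 2) (#gates-encode gs rest))) h))
    ⟫ runs refl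
    where
    loop : ∀ r {w w′} (gs : Gates w w′) (v : Vec Bool w) → length (encodeGates gs ++ rest) ≤ N → #gates gs ≤ r →
      iter r (run N gateProg) ((encodeGates gs ++ rest) ∷ toList v ∷ [] ∷ [] ∷ [])
      ≡ (true ∷ true ∷ rest) ∷ toList (evalGates gs v) ∷ [] ∷ [] ∷ []
    loop zero    []       v h _ = refl
    loop (suc r) []       v h _ = loop r [] v h z≤n
    loop (suc r) (g ∷ gs) v h (s≤s l) rewrite ++-assoc (encodeGate g) (encodeGates gs) rest =
      trans (cong (iter r (run N gateProg)) (result (gate-runs g v h)))
            (loop r gs (evalGate g v ∷ v) (≤-trans (<⇒≤ (encodeGate-suffix g _)) h) l)

  outputs-runs : ∀ {w m} (os : Vec (Fin w) m) (v : Vec Bool w) {bs} → length (encodeOutputs os) ≤ N →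
    Runs outputsProg (encodeOutputs os ∷ toList v ∷ [] ∷ bs ∷ [])
                     ([] ∷ toList v ∷ [] ∷ (toList (Vec.map (lookup v) os) ʳ++ bs) ∷ [])
  outputs-runs os v h = runs (loop N os v h (≤-trans (encodeOutputs-length os) h))
    where
    body = case 0F skip readWire readWire
    enter : ∀ {w} (i : Fin w) rest {v bs} → run N body ((encodeWire i ++ rest) ∷ v ∷ [] ∷ bs ∷ [])
                                     ≡ run N readWire ((encodeWire i ++ rest) ∷ v ∷ [] ∷ bs ∷ [])
    enter zero    rest = refl
    enter (suc i) rest = refl
    loop : ∀ r {w m} (os : Vec (Fin w) m) (v : Vec Bool w) {bs} → length (encodeOutputs os) ≤ N → m ≤ r →
      iter r (run N body) (encodeOutputs os ∷ toList v ∷ [] ∷ bs ∷ [])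
      ≡ [] ∷ toList v ∷ [] ∷ (toList (Vec.map (lookup v) os) ʳ++ bs) ∷ []
    loop zero    []       v h _ = refl
    loop (suc r) []       v h _ = loop r [] v h z≤n
    loop (suc r) (o ∷ os) v h (s≤s l) =
      trans (cong (iter r (run N body)) (trans (enter o _)
              (result (readWire-runs v o (≤-trans (toℕ≤length-encodeWire o _) h)))))
            (loop r os v (≤-trans (encodeWire-suffix o _) h) l)

  eval-runs : ∀ {n m} (C : Circuit n m) (x : Vec Bool n) {bs} →
    let open Circuit C; code = encodeGates gates ++ encodeOutputs outputs in length code ≤ N →
    Runs evalProg (code ∷ toList x ∷ [] ∷ [] ∷ bs ∷ [])
                  ([] ∷ toList (evalGates gates x) ∷ [] ∷ [] ∷ (toList (eval C x) ʳ++ bs) ∷ [])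
  eval-runs (circuit gs os) x h =
    call (0F ∷ 1F ∷ 2F ∷ 3F ∷ []) (gates-runs gs x h) refl refl
    ⟫ call (0F ∷ 1F ∷ 2F ∷ 4F ∷ [])
        (outputs-runs os (evalGates gs x) (≤-trans (≤-trans (m≤n+m _ _) (#gates-encode gs _)) h)) refl refl

-- The walk as a stack program

pattern 10F = suc 9F
pattern 11F = suc 10F
pattern 12F = suc 11F
pattern 13F = suc 12F
pattern 14F = suc 13F

-- Registers: circuit, scratch, code, state, two scratch stacks, history.
-- Puts the current block of a player on top of the history.
presentProg : Prog 7
presentProg = case 3F skip
    (push 6F false ⨾ push 6F false ⨾ pop 3F
     ⨾ rename (0F ∷ 1F ∷ 2F ∷ []) copy ⨾ rename (2F ∷ 3F ∷ 4F ∷ 5F ∷ 6F ∷ []) evalProg)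
    skip
  ⨾ rename (3F ∷ []) clear

-- Further registers: counter, right child.
expandProg : Prog 9
expandProg = rename (0F ∷ 1F ∷ 2F ∷ 3F ∷ 4F ∷ 5F ∷ 6F ∷ []) presentProg
           ⨾ rename (7F ∷ 1F ∷ 6F ∷ 3F ∷ 8F ∷ []) readBlock

-- Registers: circuit, counter, remaining levels, path; state, history and right child
-- of either player; verdicts; four scratch stacks.
goLeft goRight levelProg leafProg walkProg : Prog 15
goLeft = rename (6F ∷ []) clear ⨾ rename (9F ∷ []) clear ⨾ rename (13F ∷ 10F ∷ []) moveTop ⨾ push 3F false
goRight = rename (4F ∷ []) clear ⨾ rename (7F ∷ []) clear
        ⨾ rename (6F ∷ 11F ∷ []) mv ⨾ rename (11F ∷ 4F ∷ []) mv
        ⨾ rename (9F ∷ 11F ∷ []) mv ⨾ rename (11F ∷ 7F ∷ []) mv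
        ⨾ rename (4F ∷ 7F ∷ 11F ∷ 12F ∷ 13F ∷ []) cmpProg
        ⨾ rename (13F ∷ 10F ∷ []) moveTop ⨾ push 3F true
levelProg = rename (0F ∷ 11F ∷ 12F ∷ 4F ∷ 13F ∷ 14F ∷ 5F ∷ 1F ∷ 6F ∷ []) expandProg
          ⨾ rename (0F ∷ 11F ∷ 12F ∷ 7F ∷ 13F ∷ 14F ∷ 8F ∷ 1F ∷ 9F ∷ []) expandProg
          ⨾ rename (4F ∷ 7F ∷ 11F ∷ 12F ∷ 13F ∷ []) cmpProg
          ⨾ case 4F skip (case 13F goRight goLeft goLeft) goLeft

testBit : Prog 1
testBit = case 0F (push 0F false) (pop 0F ⨾ push 0F true) skip

leafProg = rename (0F ∷ 11F ∷ 12F ∷ 4F ∷ 13F ∷ 14F ∷ 5F ∷ []) presentProg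
         ⨾ rename (0F ∷ 11F ∷ 12F ∷ 7F ∷ 13F ∷ 14F ∷ 8F ∷ []) presentProg
         ⨾ rename (3F ∷ 5F ∷ 11F ∷ 12F ∷ 6F ∷ []) cmpProg
         ⨾ rename (3F ∷ 8F ∷ 11F ∷ 12F ∷ 9F ∷ []) cmpProg
         ⨾ rename (6F ∷ []) testBit ⨾ rename (9F ∷ []) testBit
         ⨾ rename (6F ∷ 9F ∷ 11F ∷ 12F ∷ 13F ∷ []) cmpProg
         ⨾ rename (13F ∷ 10F ∷ []) moveTop
walkProg = for (case 2F skip skip (pop 2F ⨾ levelProg)) ⨾ leafProg

ʳ++-++ : ∀ (xs ys zs : BitString) → (xs ʳ++ ys) ++ zs ≡ xs ʳ++ (ys ++ zs)
ʳ++-++ []       ys zs = refl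
ʳ++-++ (x ∷ xs) ys zs = ʳ++-++ xs (x ∷ ys) zs

cmp-short : ∀ xs ys → cmp xs ys ≡ [] ⊎ (∃[ b ] cmp xs ys ≡ b ∷ [])
cmp-short []           _            = inj₁ refl
cmp-short (false ∷ _)  []           = inj₁ refl
cmp-short (true ∷ _)   []           = inj₁ refl
cmp-short (false ∷ xs) (false ∷ ys) = cmp-short xs ys
cmp-short (true ∷ xs)  (true ∷ ys)  = cmp-short xs ys
cmp-short (false ∷ _)  (true ∷ _)   = inj₂ (true , refl)
cmp-short (true ∷ _)   (false ∷ _)  = inj₂ (false , refl)

differ-cmp : ∀ xs ys → length xs ≡ length ys → differ (cmp xs ys) ≡ not (does (Listₚ.≡-dec Boolₚ._≟_ ys xs))
differ-cmp xs ys e with Listₚ.≡-dec Boolₚ._≟_ ys xs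
... | yes refl = cong differ (cmp-refl xs)
... | no ne    = go xs ys e ne
  where
  go : ∀ xs ys → length xs ≡ length ys → ys ≢ xs → differ (cmp xs ys) ≡ true
  go []           []           _ ne = ⊥-elim (ne refl)
  go (false ∷ xs) (false ∷ ys) e ne = go xs ys (suc-injective e) (λ p → ne (cong (false ∷_) p))
  go (true ∷ xs)  (true ∷ ys)  e ne = go xs ys (suc-injective e) (λ p → ne (cong (true ∷_) p))
  go (false ∷ _)  (true ∷ _)   _ _  = refl
  go (true ∷ _)   (false ∷ _)  _ _  = refl

-- Correctness of the walk program

module Halves {n : ℕ} (C : Circuit n (2 * n)) where

  halves : Vec Bool n → Vec Bool n × Vec Bool n
  halves x = Vec.take n (eval C x) , Vec.cast (+-identityʳ n) (Vec.drop n (eval C x))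

  toList-halves : ∀ x → toList (proj₁ (halves x)) ++ toList (proj₂ (halves x)) ≡ toList (eval C x)
  toList-halves x =
    trans (cong (toList (Vec.take n u) ++_) (Vecₚ.toList-cast (+-identityʳ n) (Vec.drop n u)))
    (trans (sym (Vecₚ.toList-++ (Vec.take n u) (Vec.drop n u)))
           (cong toList (Vecₚ.take++drop≡id n u)))
    where u = eval C x

  open Korten halves public

  encodeBlocks : List Block → BitString
  encodeBlocks []      = []
  encodeBlocks (B ∷ h) = encB B ++ encodeBlocks h

  length-encB : ∀ B → length (encB B) ≡ 2 + (n + n)
  length-encB (block k l a b) =
    trans (length-ʳ++ (toList a ++ toList b))
    (trans (cong (_+ 2) (trans (length-++ (toList a)) (cong₂ _+_ (Vecₚ.length-toList a) (Vecₚ.length-toList b))))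
           (+-comm (n + n) 2))

  str-child : ∀ k v → str (child k v) ≡ k ∷ toList v
  str-child false v = refl
  str-child true  v = refl

  Fits : State → Set
  Fits s = length (str s) ≤ suc n

  length-child : ∀ k v → length (str (child k v)) ≡ suc n
  length-child k v = trans (cong length (str-child k v)) (cong suc (Vecₚ.length-toList v))

  length-rest : ∀ s h {k} → suc k < length h → k < length (rest s h)
  length-rest (done _)  h       p       = <-trans (n<1+n _) p
  length-rest (partial _) (_ ∷ h) (s≤s p) = p

  module _ (N : ℕ) where
    open Library N
    open Circuits N
    open Circuit C

    code : BitString
    code = encodeGates gates ++ encodeOutputs outputs

    module Walking (code≤ : length code ≤ N) (wires≤ : wires ≤ N) (2n≤ : 2 + (n + n) ≤ N) where

      1+n≤ : suc n ≤ N
      1+n≤ = ≤-trans (s≤s (m≤n⇒m≤1+n (m≤m+n n n))) 2n≤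

      present-runs : ∀ s h {rs} → Fits s → 0 < length h →
        Runs presentProg (code ∷ [] ∷ [] ∷ str s ∷ [] ∷ [] ∷ (encodeBlocks h ++ rs) ∷ [])
                         (code ∷ [] ∷ [] ∷ [] ∷ [] ∷ [] ∷ (encB (current s h) ++ encodeBlocks (rest s h) ++ rs) ∷ [])
      present-runs (partial j) (B ∷ h) {rs} fits _ =
        case-true refl (runs refl)
        ⟫ call (3F ∷ []) (clear-runs (≤-trans fits 1+n≤)) refl
               (cong (λ w → code ∷ [] ∷ [] ∷ [] ∷ [] ∷ [] ∷ w ∷ []) (++-assoc (encB B) (encodeBlocks h) rs))
      -- The circuit's outputs are pushed in order onto the kinds 00, so they lie there reversed,
      -- which is exactly the encoding of `image v`.
      present-runs (done v) h {rs} fits _ =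
        case-false refl
          (runs refl ⟫ runs refl ⟫ runs refl
          ⟫ call (0F ∷ 1F ∷ 2F ∷ []) (copy-runs code≤) refl refl
          ⟫ call (2F ∷ 3F ∷ 4F ∷ 5F ∷ 6F ∷ []) (eval-runs C v code≤) refl refl)
        ⟫ call (3F ∷ []) (clear-runs (subst (_≤ N) (sym (Vecₚ.length-toList (evalGates gates v))) wires≤)) refl
               (cong (λ w → code ∷ [] ∷ [] ∷ [] ∷ [] ∷ [] ∷ w ∷ [])
                 (trans (cong (_ʳ++ (false ∷ false ∷ encodeBlocks h ++ rs)) (sym (toList-halves v)))
                        (sym (ʳ++-++ (toList (proj₁ (halves v)) ++ toList (proj₂ (halves v))) _ _))))

      expand-runs : ∀ s h {rs} → Fits s → 0 < length h → let B = current s h in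
        Runs expandProg (code ∷ [] ∷ [] ∷ str s ∷ [] ∷ [] ∷ (encodeBlocks h ++ rs) ∷ trues n ∷ [] ∷ [])
                        (code ∷ [] ∷ [] ∷ str (left B) ∷ [] ∷ [] ∷ (encodeBlocks (rest s h) ++ rs) ∷ trues n ∷ str (right B) ∷ [])
      expand-runs s h {rs} fits nonempty with current s h | present-runs s h {rs} fits nonempty
      ... | block k l a b | presented =
        call (0F ∷ 1F ∷ 2F ∷ 3F ∷ 4F ∷ 5F ∷ 6F ∷ []) presented refl refl
        ⟫ call (7F ∷ 1F ∷ 6F ∷ 3F ∷ 8F ∷ [])
            (readBlock-runs {n} (toList a) (toList b) k l (encodeBlocks (rest s h) ++ rs)
              (Vecₚ.length-toList a) (Vecₚ.length-toList b) (≤-trans (n≤1+n n) 1+n≤))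
            (cong (λ w → trues n ∷ [] ∷ w ∷ [] ∷ [] ∷ []) (ʳ++-++ (toList a ++ toList b) _ _))
            (cong₂ (λ u w → code ∷ [] ∷ [] ∷ u ∷ [] ∷ [] ∷ (encodeBlocks (rest s h) ++ rs) ∷ trues n ∷ w ∷ [])
              (sym (str-child k a)) (sym (str-child l b)))

      verdict-runs : ∀ xs ys W → Runs moveTop (cmp xs ys ∷ W ∷ []) ([] ∷ (cmp xs ys ++ W) ∷ [])
      verdict-runs xs ys W with cmp xs ys | cmp-short xs ys
      ... | .[]          | inj₁ refl       = runs refl
      ... | .(b ∷ [])    | inj₂ (b , refl) = moveTop-runs b [] W

      testBit-runs : ∀ xs ys → Runs testBit (cmp xs ys ∷ []) ((differ (cmp xs ys) ∷ []) ∷ [])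
      testBit-runs xs ys with cmp xs ys | cmp-short xs ys
      ... | .[]          | inj₁ refl           = runs refl
      ... | .(false ∷ []) | inj₂ (false , refl) = runs refl
      ... | .(true ∷ [])  | inj₂ (true , refl)  = runs refl

      compare-runs : ∀ {xs ys} → length xs ≡ length ys → length xs ≤ N →
        Runs cmpProg (xs ∷ ys ∷ [] ∷ [] ∷ [] ∷ []) (xs ∷ ys ∷ [] ∷ [] ∷ cmp xs ys ∷ [])
      compare-runs {xs} {ys} e h =
        subst (λ w → Runs cmpProg (xs ∷ w ∷ [] ∷ [] ∷ [] ∷ []) (xs ∷ w ∷ [] ∷ [] ∷ cmp xs ys ∷ []))
              (++-identityʳ ys) (cmpProg-runs {zs = []} e h)

      at : (k : ℕ) (p v₁ h₁ b₁ v₂ h₂ b₂ W c : BitString) → Store 15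
      at k p v₁ h₁ b₁ v₂ h₂ b₂ W c =
        code ∷ trues n ∷ trues k ∷ leaf p ∷ v₁ ∷ h₁ ∷ b₁ ∷ v₂ ∷ h₂ ∷ b₂ ∷ W ∷ [] ∷ [] ∷ c ∷ [] ∷ []

      goLeft-runs : ∀ {k p v₁ h₁ v₂ h₂ W} xs ys {b₁ b₂} → length b₁ ≤ N → length b₂ ≤ N →
        Runs goLeft (at k p v₁ h₁ b₁ v₂ h₂ b₂ W (cmp xs ys)) (at k (false ∷ p) v₁ h₁ [] v₂ h₂ [] (cmp xs ys ++ W) [])
      goLeft-runs xs ys {b₁} {b₂} l₁ l₂ =
        call (6F ∷ []) (clear-runs l₁) refl refl
        ⟫ call (9F ∷ []) (clear-runs l₂) refl refl
        ⟫ call (13F ∷ 10F ∷ []) (verdict-runs xs ys _) refl refl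
        ⟫ runs refl

      goRight-runs : ∀ {k p v₁ h₁ v₂ h₂ W b₁ b₂} →
        length v₁ ≤ N → length v₂ ≤ N → length b₁ ≡ length b₂ → length b₁ ≤ N →
        Runs goRight (at k p v₁ h₁ b₁ v₂ h₂ b₂ W []) (at k (true ∷ p) b₁ h₁ [] b₂ h₂ [] (cmp b₁ b₂ ++ W) [])
      goRight-runs {k} {p} {v₁} {h₁} {v₂} {h₂} {W} {b₁} {b₂} l₁ l₂ e l =
        call (4F ∷ []) (clear-runs l₁) refl refl
        ⟫ call (7F ∷ []) (clear-runs l₂) refl refl
        ⟫ call (6F ∷ 11F ∷ []) (mv-runs [] l) refl refl
        ⟫ call (11F ∷ 4F ∷ []) (mv-runs [] (subst (_≤ N) (sym (ʳ++-[]-length b₁)) l)) refl refl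
        ⟫ call (9F ∷ 11F ∷ []) (mv-runs [] (subst (_≤ N) e l)) refl refl
        ⟫ call (11F ∷ 7F ∷ []) (mv-runs [] (subst (_≤ N) (trans e (sym (ʳ++-[]-length b₂))) l)) refl
            (cong₂ (λ u w → at k p u h₁ [] w h₂ [] W []) (unreverse-[] b₁) (unreverse-[] b₂))
        ⟫ call (4F ∷ 7F ∷ 11F ∷ 12F ∷ 13F ∷ []) (compare-runs e l) refl refl
        ⟫ call (13F ∷ 10F ∷ []) (verdict-runs b₁ b₂ _) refl refl
        ⟫ runs refl

      standing : (k : ℕ) (p : BitString) (s₁ : State) (h₁ : List Block) (s₂ : State) (h₂ : List Block)
                 (W r₁ r₂ : BitString) → Store 15
      standing k p s₁ h₁ s₂ h₂ W r₁ r₂ =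
        at k p (str s₁) (encodeBlocks h₁ ++ r₁) [] (str s₂) (encodeBlocks h₂ ++ r₂) [] W []

      child-≤ : ∀ k v → length (str (child k v)) ≤ N
      child-≤ k v = subst (_≤ N) (sym (length-child k v)) 1+n≤

      child-≡ : ∀ k v k′ v′ → length (str (child k v)) ≡ length (str (child k′ v′))
      child-≡ k v k′ v′ = trans (length-child k v) (sym (length-child k′ v′))

      module _ (k : ℕ) (p : BitString) (s₁ : State) (h₁ : List Block) (s₂ : State) (h₂ : List Block)
               (W r₁ r₂ : BitString) (fits₁ : Fits s₁) (fits₂ : Fits s₂)
               (l₁ : 0 < length h₁) (l₂ : 0 < length h₂) where

        private
          B₁ B₂ : Block
          B₁ = current s₁ h₁
          B₂ = current s₂ h₂
          c : BitString
          c = cmp (str (left B₁)) (str (left B₂))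
          left-≡ : length (str (left B₁)) ≡ length (str (left B₂))
          left-≡ = child-≡ (Block.kˡ B₁) (Block.a B₁) (Block.kˡ B₂) (Block.a B₂)
          left-≤ : ∀ B → length (str (left B)) ≤ N
          left-≤ B = child-≤ (Block.kˡ B) (Block.a B)
          right-≤ : ∀ B → length (str (right B)) ≤ N
          right-≤ B = child-≤ (Block.kʳ B) (Block.b B)

          choice : Prog 15
          choice = case 4F skip (case 13F goRight goLeft goLeft) goLeft

          lefts rights : Store 15
          lefts  = standing k (false ∷ p) (left B₁) (rest s₁ h₁) (left B₂) (rest s₂ h₂) (c ++ W) r₁ r₂
          rights = standing k (true ∷ p) (right B₁) (rest s₁ h₁) (right B₂) (rest s₂ h₂)
                            (cmp (str (right B₁)) (str (right B₂)) ++ W) r₁ r₂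

          before : BitString → Store 15
          before = at k p (str (left B₁)) (encodeBlocks (rest s₁ h₁) ++ r₁) (str (right B₁))
                          (str (left B₂)) (encodeBlocks (rest s₂ h₂) ++ r₂) (str (right B₂)) W

          toLeft : Runs goLeft (before c) lefts
          toLeft = goLeft-runs (str (left B₁)) (str (left B₂)) (right-≤ B₁) (right-≤ B₂)

          choice-left : isPartial (left B₁) ∨ differ c ≡ true → Runs choice (before c) lefts
          choice-left with left B₁ in e₁ | toLeft
          ... | partial _ | go = λ _ → case-true refl go
          ... | done v  | go with cmp (false ∷ toList v) (str (left B₂)) | go
          ...   | false ∷ _ | go′ = λ _ → case-false refl (case-false refl go′)
          ...   | true ∷ _  | go′ = λ _ → case-false refl (case-true refl go′)

          toRight : Runs goRight (before []) rights
          toRight = goRight-runs (left-≤ B₁) (left-≤ B₂)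
                      (child-≡ (Block.kʳ B₁) (Block.b B₁) (Block.kʳ B₂) (Block.b B₂)) (right-≤ B₁)

          choice-right : isPartial (left B₁) ∨ differ c ≡ false → Runs choice (before c) rights
          choice-right with left B₁ in e₁ | toRight
          ... | done v | go with cmp (false ∷ toList v) (str (left B₂))
          ...   | [] = λ _ → case-false refl (case-[] refl go)

          level-common : ∀ {τ} → Runs choice (before c) τ → Runs levelProg (standing k p s₁ h₁ s₂ h₂ W r₁ r₂) τ
          level-common go =
            call (0F ∷ 11F ∷ 12F ∷ 4F ∷ 13F ∷ 14F ∷ 5F ∷ 1F ∷ 6F ∷ []) (expand-runs s₁ h₁ fits₁ l₁) refl refl
            ⟫ call (0F ∷ 11F ∷ 12F ∷ 7F ∷ 13F ∷ 14F ∷ 8F ∷ 1F ∷ 9F ∷ []) (expand-runs s₂ h₂ fits₂ l₂) refl refl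
            ⟫ call (4F ∷ 7F ∷ 11F ∷ 12F ∷ 13F ∷ []) (compare-runs left-≡ (left-≤ B₁)) refl refl
            ⟫ go

        level-left : isPartial (left B₁) ∨ differ c ≡ true → Runs levelProg (standing k p s₁ h₁ s₂ h₂ W r₁ r₂) lefts
        level-left e = level-common (choice-left e)

        level-right : isPartial (left B₁) ∨ differ c ≡ false → Runs levelProg (standing k p s₁ h₁ s₂ h₂ W r₁ r₂) rights
        level-right e = level-common (choice-right e)

-- The verifier

pattern 15F = suc 14F
pattern 16F = suc 15F
pattern 17F = suc 16F

unaryProg : Prog 2
unaryProg = for (case 0F skip skip (pop 0F ⨾ push 1F true)) ⨾ pop 0F

-- Registers: history, counter, two halves, scratch, flag, output.
extractBody extractProg : Prog 7
extractBody = case 5F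
  (rename (1F ∷ 4F ∷ 0F ∷ 2F ∷ 3F ∷ []) readBlock
   ⨾ case 2F skip (case 3F skip (push 5F true) discard) discard)
  skip skip
  where
  discard : Prog 7
  discard = rename (2F ∷ []) clear ⨾ rename (3F ∷ []) clear
extractProg = for extractBody ⨾ pop 2F ⨾ pop 3F
  ⨾ rename (3F ∷ 4F ∷ []) mv ⨾ rename (4F ∷ 6F ∷ []) mv
  ⨾ rename (2F ∷ 4F ∷ []) mv ⨾ rename (4F ∷ 6F ∷ []) mv

walkRegisters : Vec (Fin 18) 15
walkRegisters = 0F ∷ 4F ∷ 5F ∷ 6F ∷ 7F ∷ 8F ∷ 9F ∷ 10F ∷ 11F ∷ 12F ∷ 13F ∷ 14F ∷ 15F ∷ 16F ∷ 17F ∷ []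

answerProg : Prog 18
answerProg = case 13F (answer 1F) (answer 2F) (answer 1F)
  where
  answer : Fin 18 → Prog 18
  answer i = rename (i ∷ 4F ∷ 7F ∷ 10F ∷ 14F ∷ 15F ∷ 3F ∷ []) extractProg

-- Registers: circuit, two proofs, output, then those of walkProg without the circuit.
prepareProg verifier : Prog 18
prepareProg = rename (0F ∷ 4F ∷ []) unaryProg ⨾ rename (0F ∷ 5F ∷ []) unaryProg
  ⨾ rename (1F ∷ 14F ∷ 8F ∷ []) copyLong ⨾ rename (2F ∷ 14F ∷ 11F ∷ []) copyLong
  ⨾ push 6F false ⨾ push 6F false ⨾ push 7F true ⨾ push 10F true
verifier = prepareProg
  ⨾ rename walkRegisters walkProg
  ⨾ answerProg

-- Correctness of the verifier program

module Correct {n : ℕ} (C : Circuit n (2 * n)) (N : ℕ) where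
  open Halves C
  open Library N
  open Circuits N
  open Circuit C

  unary-runs : ∀ m {rest} → m ≤ N → Runs unaryProg ((unary m ++ rest) ∷ [] ∷ []) (rest ∷ trues m ∷ [])
  unary-runs m {rest} h =
    runs (trans (loop N m 0 h) (cong (λ k → (false ∷ rest) ∷ trues k ∷ []) (+-identityʳ m))) ⟫ runs refl
    where
    loop : ∀ r m k → m ≤ r → iter r (run N (case 0F skip skip (pop 0F ⨾ push 1F true))) ((unary m ++ rest) ∷ trues k ∷ [])
           ≡ (false ∷ rest) ∷ trues (m + k) ∷ []
    loop zero    zero    k _       = refl
    loop (suc r) zero    k _       = loop r zero k z≤n
    loop (suc r) (suc m) k (s≤s h) =
      trans (loop r m (suc k) h) (cong (λ j → (false ∷ rest) ∷ trues j ∷ []) (+-suc m k))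

  module _ (code≤ : length (code N) ≤ N) (wires≤ : wires ≤ N) (2n≤ : 2 + (n + n) ≤ N) where
    open Walking N code≤ wires≤ 2n≤

    private
      levelBody : Prog 15
      levelBody = case 2F skip skip (pop 2F ⨾ levelProg)

    -- Where the descent ends depends on both histories. `same-walk` reduces the walk to its last
    -- step there, and `length-p′` makes the path as long as the block it is compared with.
    record Reaches (k : ℕ) (p : BitString) (s₁ : State) (h₁ : List Block) (s₂ : State) (h₂ : List Block)
                   (W r₁ r₂ : BitString) (σ : Store 15) : Set where
      field
        p′ : BitString
        s₁′ s₂′ : State
        h₁′ h₂′ : List Block
        W′ : BitString
        stands : σ ≡ standing 0 p′ s₁′ h₁′ s₂′ h₂′ W′ r₁ r₂
        length-p′ : length p′ ≡ k + length p
        fits₁ : Fits s₁′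
        fits₂ : Fits s₂′
        nonempty₁ : 0 < length h₁′
        nonempty₂ : 0 < length h₂′
        same-walk : walk k p s₁ h₁ s₂ h₂ W ≡ walk 0 p′ s₁′ h₁′ s₂′ h₂′ W′

    fits-child : ∀ k v → Fits (child k v)
    fits-child k v = ≤-reflexive (length-child k v)

    extend : ∀ {k p p₁ s₁ h₁ s₂ h₂ W s₁′ h₁′ s₂′ h₂′ W′ r₁ r₂ σ′} r σ → length p₁ ≡ suc (length p) →
      walk (suc k) p s₁ h₁ s₂ h₂ W ≡ walk k p₁ s₁′ h₁′ s₂′ h₂′ W′ → Runs levelBody σ σ′ →
      Reaches k p₁ s₁′ h₁′ s₂′ h₂′ W′ r₁ r₂ (iter r (run N levelBody) σ′) →
      Reaches (suc k) p s₁ h₁ s₂ h₂ W r₁ r₂ (iter (suc r) (run N levelBody) σ)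
    extend {k} r σ lp same r₀ rec = record
      { stands = trans (cong (iter r (run N levelBody)) (result r₀)) (stands rec)
      ; length-p′ = trans (length-p′ rec) (trans (cong (k +_) lp) (+-suc k _))
      ; fits₁ = fits₁ rec ; fits₂ = fits₂ rec ; nonempty₁ = nonempty₁ rec ; nonempty₂ = nonempty₂ rec
      ; same-walk = trans same (same-walk rec) }
      where open Reaches

    levels : ∀ r k p s₁ h₁ s₂ h₂ W r₁ r₂ → k ≤ r → Fits s₁ → Fits s₂ → k < length h₁ → k < length h₂ →
             Reaches k p s₁ h₁ s₂ h₂ W r₁ r₂ (iter r (run N levelBody) (standing k p s₁ h₁ s₂ h₂ W r₁ r₂))
    levels zero    zero p s₁ h₁ s₂ h₂ W r₁ r₂ _ f₁ f₂ l₁ l₂ = record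
      { stands = refl ; length-p′ = refl ; fits₁ = f₁ ; fits₂ = f₂ ; nonempty₁ = l₁ ; nonempty₂ = l₂ ; same-walk = refl }
    -- Surplus iterations find the level counter empty and do nothing.
    levels (suc r) zero p s₁ h₁ s₂ h₂ W r₁ r₂ _ f₁ f₂ l₁ l₂ = levels r zero p s₁ h₁ s₂ h₂ W r₁ r₂ z≤n f₁ f₂ l₁ l₂
    -- The test is generalized together with an equation, because the walk and the program both
    -- branch on it.
    levels (suc r) (suc k) p s₁ h₁ s₂ h₂ W r₁ r₂ (s≤s k≤r) f₁ f₂ l₁ l₂ = descend _ refl
      where
      B₁ B₂ : Block
      B₁ = current s₁ h₁
      B₂ = current s₂ h₂
      c c′ : BitString
      c  = cmp (str (left B₁)) (str (left B₂))
      c′ = cmp (str (right B₁)) (str (right B₂))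
      descend : ∀ b → isPartial (left B₁) ∨ differ c ≡ b →
        Reaches (suc k) p s₁ h₁ s₂ h₂ W r₁ r₂ (iter (suc r) (run N levelBody) (standing (suc k) p s₁ h₁ s₂ h₂ W r₁ r₂))
      descend true e = extend r (standing (suc k) p s₁ h₁ s₂ h₂ W r₁ r₂) refl
        (cong (if_then walk k (false ∷ p) (left B₁) (rest s₁ h₁) (left B₂) (rest s₂ h₂) (c ++ W)
                   else walk k (true ∷ p) (right B₁) (rest s₁ h₁) (right B₂) (rest s₂ h₂) (c′ ++ W)) e)
        (case-true refl (runs refl ⟫
          level-left k p s₁ h₁ s₂ h₂ W r₁ r₂ f₁ f₂ (≤-trans (s≤s z≤n) l₁) (≤-trans (s≤s z≤n) l₂) e))
        (levels r k (false ∷ p) (left B₁) (rest s₁ h₁) (left B₂) (rest s₂ h₂) (c ++ W) r₁ r₂ k≤r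
          (fits-child (Block.kˡ B₁) (Block.a B₁)) (fits-child (Block.kˡ B₂) (Block.a B₂))
          (length-rest s₁ h₁ l₁) (length-rest s₂ h₂ l₂))
      descend false e = extend r (standing (suc k) p s₁ h₁ s₂ h₂ W r₁ r₂) refl
        (cong (if_then walk k (false ∷ p) (left B₁) (rest s₁ h₁) (left B₂) (rest s₂ h₂) (c ++ W)
                   else walk k (true ∷ p) (right B₁) (rest s₁ h₁) (right B₂) (rest s₂ h₂) (c′ ++ W)) e)
        (case-true refl (runs refl ⟫
          level-right k p s₁ h₁ s₂ h₂ W r₁ r₂ f₁ f₂ (≤-trans (s≤s z≤n) l₁) (≤-trans (s≤s z≤n) l₂) e))
        (levels r k (true ∷ p) (right B₁) (rest s₁ h₁) (right B₂) (rest s₂ h₂) (c′ ++ W) r₁ r₂ k≤r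
          (fits-child (Block.kʳ B₁) (Block.b B₁)) (fits-child (Block.kʳ B₂) (Block.b B₂))
          (length-rest s₁ h₁ l₁) (length-rest s₂ h₂ l₂))

    length-leaf : ∀ p → length p ≡ n + n → length (leaf p) ≡ 2 + (n + n)
    length-leaf p e = trans (length-++ p) (trans (+-comm (length p) 2) (cong (2 +_) e))

    leaf-runs : ∀ p s₁ h₁ s₂ h₂ W r₁ r₂ → length p ≡ n + n → Fits s₁ → Fits s₂ → 0 < length h₁ → 0 < length h₂ →
      ∃[ e₁ ] ∃[ e₂ ] ∃[ t₁ ] ∃[ t₂ ]
      Runs leafProg (standing 0 p s₁ h₁ s₂ h₂ W r₁ r₂) (at 0 p [] t₁ e₁ [] t₂ e₂ (walk 0 p s₁ h₁ s₂ h₂ W) [])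
    leaf-runs p s₁ h₁ s₂ h₂ W r₁ r₂ lp f₁ f₂ l₁ l₂ = _ , _ , _ , _ ,
      (call (0F ∷ 11F ∷ 12F ∷ 4F ∷ 13F ∷ 14F ∷ 5F ∷ []) (present-runs s₁ h₁ f₁ l₁) refl refl
      ⟫ call (0F ∷ 11F ∷ 12F ∷ 7F ∷ 13F ∷ 14F ∷ 8F ∷ []) (present-runs s₂ h₂ f₂ l₂) refl refl
      ⟫ call (3F ∷ 5F ∷ 11F ∷ 12F ∷ 6F ∷ []) (cmpProg-runs (leaf-≡ B₁) leaf≤) refl refl
      ⟫ call (3F ∷ 8F ∷ 11F ∷ 12F ∷ 9F ∷ []) (cmpProg-runs (leaf-≡ B₂) leaf≤) refl refl
      ⟫ call (6F ∷ []) (testBit-runs (leaf p) (encB B₁)) refl refl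
      ⟫ call (9F ∷ []) (testBit-runs (leaf p) (encB B₂)) refl refl
      ⟫ call (6F ∷ 9F ∷ 11F ∷ 12F ∷ 13F ∷ []) (compare-runs refl (≤-trans (s≤s z≤n) 2n≤)) refl refl
      ⟫ call (13F ∷ 10F ∷ []) (verdict-runs (d₁ ∷ []) (d₂ ∷ []) W) refl
          (cong₂ (λ x y → at 0 p [] (encB B₁ ++ encodeBlocks (rest s₁ h₁) ++ r₁) (d₁ ∷ [])
                           [] (encB B₂ ++ encodeBlocks (rest s₂ h₂) ++ r₂) (d₂ ∷ []) (cmp (x ∷ []) (y ∷ []) ++ W) [])
            (differ-cmp (leaf p) (encB B₁) (leaf-≡ B₁)) (differ-cmp (leaf p) (encB B₂) (leaf-≡ B₂))))
      where
      B₁ B₂ : Block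
      B₁ = current s₁ h₁
      B₂ = current s₂ h₂
      d₁ d₂ : Bool
      d₁ = differ (cmp (leaf p) (encB B₁))
      d₂ = differ (cmp (leaf p) (encB B₂))
      leaf-≡ : ∀ B → length (leaf p) ≡ length (encB B)
      leaf-≡ B = trans (length-leaf p lp) (sym (length-encB B))
      leaf≤ : length (leaf p) ≤ N
      leaf≤ = subst (_≤ N) (sym (length-leaf p lp)) 2n≤

    walk-runs : ∀ k p s₁ h₁ s₂ h₂ W r₁ r₂ → k + length p ≡ n + n → k ≤ N →
      Fits s₁ → Fits s₂ → k < length h₁ → k < length h₂ →
      ∃[ p′ ] ∃[ e₁ ] ∃[ e₂ ] ∃[ t₁ ] ∃[ t₂ ]
      Runs walkProg (standing k p s₁ h₁ s₂ h₂ W r₁ r₂) (at 0 p′ [] t₁ e₁ [] t₂ e₂ (walk k p s₁ h₁ s₂ h₂ W) [])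
    walk-runs k p s₁ h₁ s₂ h₂ W r₁ r₂ e k≤ f₁ f₂ l₁ l₂ =
      let open Reaches (levels N k p s₁ h₁ s₂ h₂ W r₁ r₂ k≤ f₁ f₂ l₁ l₂)
          e₁ , e₂ , t₁ , t₂ , finish = leaf-runs p′ s₁′ h₁′ s₂′ h₂′ W′ r₁ r₂ (trans length-p′ e) fits₁ fits₂ nonempty₁ nonempty₂
      in p′ , e₁ , e₂ , t₁ , t₂ ,
         (runs stands ⟫ to finish (cong (λ w → at 0 p′ [] t₁ e₁ [] t₂ e₂ w []) (sym same-walk)))

    extract-runs : ∀ h {y rs} → extract h ≡ just y → length h ≤ N → ∃[ t ]
      Runs extractProg ((encodeBlocks h ++ rs) ∷ trues n ∷ [] ∷ [] ∷ [] ∷ [] ∷ [] ∷ [])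
                       (t ∷ trues n ∷ [] ∷ [] ∷ [] ∷ (true ∷ []) ∷ y ∷ [])
    extract-runs h {y} {rs} ext lh =
      let t , a , b , found , y≡ = search N h ext lh
          la = subst (_≤ N) (sym (Vecₚ.length-toList a)) n≤
          lb = subst (_≤ N) (sym (Vecₚ.length-toList b)) n≤
          as = toList a
          bs = toList b
      in t , (runs found ⟫ runs refl ⟫ runs refl
         -- The right half goes first, so that the left half ends on top of it; passing through the
         -- scratch stack preserves the order of bits.
         ⟫ call (3F ∷ 4F ∷ []) (mv-runs [] lb) refl refl
         ⟫ call (4F ∷ 6F ∷ []) (mv-runs [] (subst (_≤ N) (sym (ʳ++-[]-length bs)) lb)) refl refl
         ⟫ call (2F ∷ 4F ∷ []) (mv-runs [] la) refl refl
         ⟫ call (4F ∷ 6F ∷ []) (mv-runs _ (subst (_≤ N) (sym (ʳ++-[]-length as)) la)) refl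
             (cong (λ w → t ∷ trues n ∷ [] ∷ [] ∷ [] ∷ (true ∷ []) ∷ w ∷ [])
               (trans (unreverse as _) (trans (cong (as ++_) (unreverse-[] bs)) (sym y≡)))))
      where
      n≤ : n ≤ N
      n≤ = ≤-trans (n≤1+n n) 1+n≤

      Block-runs : ∀ B {zs} → Runs (rename (1F ∷ 4F ∷ 0F ∷ 2F ∷ 3F ∷ []) readBlock)
        ((encB B ++ zs) ∷ trues n ∷ [] ∷ [] ∷ [] ∷ [] ∷ [] ∷ [])
        (zs ∷ trues n ∷ (Block.kˡ B ∷ toList (Block.a B)) ∷ (Block.kʳ B ∷ toList (Block.b B)) ∷ [] ∷ [] ∷ [] ∷ [])
      Block-runs (block k l a b) {zs} =
        call (1F ∷ 4F ∷ 0F ∷ 2F ∷ 3F ∷ [])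
          (readBlock-runs {n} (toList a) (toList b) k l zs (Vecₚ.length-toList a) (Vecₚ.length-toList b) n≤)
          (cong (λ w → trues n ∷ [] ∷ w ∷ [] ∷ [] ∷ []) (ʳ++-++ (toList a ++ toList b) _ _)) refl

      discard-runs : ∀ {zs} k l (a b : Vec Bool n) →
        Runs (rename (2F ∷ []) clear ⨾ rename (3F ∷ []) clear)
          (zs ∷ trues n ∷ (k ∷ toList a) ∷ (l ∷ toList b) ∷ [] ∷ [] ∷ [] ∷ [])
          (zs ∷ trues n ∷ [] ∷ [] ∷ [] ∷ [] ∷ [] ∷ [])
      discard-runs k l a b =
        call (2F ∷ []) (clear-runs (fit k a)) refl refl ⟫ call (3F ∷ []) (clear-runs (fit l b)) refl refl
        where
        fit : ∀ k (v : Vec Bool n) → length (k ∷ toList v) ≤ N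
        fit k v = subst (_≤ N) (sym (cong suc (Vecₚ.length-toList v))) 1+n≤

      skipped : ∀ k l a b zs → k ∨ l ≡ true → Runs extractBody
        ((encB (block k l a b) ++ zs) ∷ trues n ∷ [] ∷ [] ∷ [] ∷ [] ∷ [] ∷ [])
        (zs ∷ trues n ∷ [] ∷ [] ∷ [] ∷ [] ∷ [] ∷ [])
      skipped true  l    a b zs _ = case-[] refl (Block-runs (block true l a b) ⟫ case-true refl (discard-runs true l a b))
      skipped false true a b zs _ =
        case-[] refl (Block-runs (block false true a b) ⟫ case-false refl (case-true refl (discard-runs false true a b)))

      kept : ∀ a b zs → Runs extractBody
        ((encB (block false false a b) ++ zs) ∷ trues n ∷ [] ∷ [] ∷ [] ∷ [] ∷ [] ∷ [])
        (zs ∷ trues n ∷ (false ∷ toList a) ∷ (false ∷ toList b) ∷ [] ∷ (true ∷ []) ∷ [] ∷ [])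
      kept a b zs = case-[] refl (Block-runs (block false false a b) ⟫ case-false refl (case-false refl (runs refl)))

      idle : ∀ r {zs c a b} → iter r (run N extractBody) (zs ∷ c ∷ a ∷ b ∷ [] ∷ (true ∷ []) ∷ [] ∷ [])
                              ≡ zs ∷ c ∷ a ∷ b ∷ [] ∷ (true ∷ []) ∷ [] ∷ []
      idle zero    = refl
      idle (suc r) = idle r

      start : BitString → Store 7
      start w = w ∷ trues n ∷ [] ∷ [] ∷ [] ∷ [] ∷ [] ∷ []

      Found : ℕ → List Block → Set
      Found r h = ∃[ t ] ∃[ a ] ∃[ b ]
        iter r (run N extractBody) (start (encodeBlocks h ++ rs))
          ≡ t ∷ trues n ∷ (false ∷ toList {n = n} a) ∷ (false ∷ toList {n = n} b) ∷ [] ∷ (true ∷ []) ∷ [] ∷ []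
        × y ≡ toList a ++ toList b

      first : ∀ r B h {σ τ} → Runs extractBody (start (encB B ++ encodeBlocks h ++ rs)) σ →
              iter r (run N extractBody) σ ≡ τ →
              iter (suc r) (run N extractBody) (start (encodeBlocks (B ∷ h) ++ rs)) ≡ τ
      first r B h (runs e) e′ =
        trans (cong (λ w → iter r (run N extractBody) (run N extractBody (start w))) (++-assoc (encB B) (encodeBlocks h) rs))
              (trans (cong (iter r (run N extractBody)) e) e′)

      later : ∀ r k l a b h → k ∨ l ≡ true → Found r h → Found (suc r) (block k l a b ∷ h)
      later r k l a b h kl (t , a′ , b′ , e , y≡) =
        t , a′ , b′ , first r (block k l a b) h (skipped k l a b (encodeBlocks h ++ rs) kl) e , y≡

      search : ∀ r h → extract h ≡ just y → length h ≤ r → Found r h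
      search (suc r) (block false false a b ∷ h) refl (s≤s l) =
        _ , a , b , first r (block false false a b) h (kept a b (encodeBlocks h ++ rs)) (idle r) , refl
      search (suc r) (block true l′ a b ∷ h) ext (s≤s l) = later r true l′ a b h refl (search r h ext l)
      search (suc r) (block false true a b ∷ h) ext (s≤s l) = later r false true a b h refl (search r h ext l)

    verdict : List Block → List Block → BitString
    verdict h₁ h₂ = walk (n + n) [] (partial []) h₁ (partial []) h₂ []

    module _ (h₁ : List Block) (r₁ : BitString) (h₂ : List Block) (r₂ : BitString) (y : BitString)
             (l₁ : length h₁ ≡ suc (n + n)) (l₂ : length h₂ ≡ suc (n + n)) where

      private
        π₁ π₂ : BitString
        π₁ = encodeBlocks h₁ ++ r₁
        π₂ = encodeBlocks h₂ ++ r₂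

        all : (g c l p v₁ a₁ b₁ v₂ a₂ b₂ w : BitString) → Store 18
        all g c l p v₁ a₁ b₁ v₂ a₂ b₂ w =
          g ∷ π₁ ∷ π₂ ∷ [] ∷ c ∷ l ∷ p ∷ v₁ ∷ a₁ ∷ b₁ ∷ v₂ ∷ a₂ ∷ b₂ ∷ w ∷ [] ∷ [] ∷ [] ∷ [] ∷ []

        fit : ∀ (h : List Block) → length h ≡ suc (n + n) → length h ≤ N
        fit h l = subst (_≤ N) (sym l) (≤-trans (n≤1+n _) 2n≤)

        -- The walk consumes copies, and the answer is read from the original proofs. An empty
        -- verdict may go to the first player: if either history is correct, the answers then
        -- coincide.
        answers : ∀ w {p a₁ b₁ a₂ b₂} → extract (onTop w h₁ h₂ h₁) ≡ just y → ∃[ σ ]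
          Runs answerProg (all (code N) (trues n) [] p [] a₁ b₁ [] a₂ b₂ w) σ × lookup σ 3F ≡ y
        answers [] ext =
          let _ , got = extract-runs h₁ {rs = r₁} ext (fit h₁ l₁)
          in _ , case-[] refl (call (1F ∷ 4F ∷ 7F ∷ 10F ∷ 14F ∷ 15F ∷ 3F ∷ []) got refl refl) , refl
        answers (false ∷ _) ext =
          let _ , got = extract-runs h₂ {rs = r₂} ext (fit h₂ l₂)
          in _ , case-false refl (call (2F ∷ 4F ∷ 7F ∷ 10F ∷ 14F ∷ 15F ∷ 3F ∷ []) got refl refl) , refl
        answers (true ∷ _) ext =
          let _ , got = extract-runs h₁ {rs = r₁} ext (fit h₁ l₁)
          in _ , case-true refl (call (1F ∷ 4F ∷ 7F ∷ 10F ∷ 14F ∷ 15F ∷ 3F ∷ []) got refl refl) , refl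

      verifier-runs : length π₁ ≤ N * N → length π₂ ≤ N * N → extract (onTop (verdict h₁ h₂) h₁ h₂ h₁) ≡ just y →
                      ∃[ σ ] Runs verifier (encode C ∷ π₁ ∷ π₂ ∷ Vec.replicate 15 []) σ × lookup σ 3F ≡ y
      verifier-runs N₁ N₂ ext =
        let p , e₁ , e₂ , t₁ , t₂ , walked =
              walk-runs (n + n) [] (partial []) h₁ (partial []) h₂ [] r₁ r₂ (+-identityʳ _)
                (≤-trans (m≤n+m (n + n) 2) 2n≤) (s≤s z≤n) (s≤s z≤n) (≤-reflexive (sym l₁)) (≤-reflexive (sym l₂))
            σ , answered , y≡ = answers (verdict h₁ h₂) {leaf p} {t₁} {e₁} {t₂} {e₂} ext
        in σ , (prepared ⟫ called walked ⟫ answered) , y≡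
        where
        called : ∀ {p e₁ e₂ t₁ t₂ w} →
          Runs walkProg (standing (n + n) [] (partial []) h₁ (partial []) h₂ [] r₁ r₂) (at 0 p [] t₁ e₁ [] t₂ e₂ w []) →
          Runs (rename walkRegisters walkProg)
            (all (code N) (trues n) (trues (n + n)) (false ∷ false ∷ []) (true ∷ []) π₁ [] (true ∷ []) π₂ [] [])
            (all (code N) (trues n) [] (leaf p) [] t₁ e₁ [] t₂ e₂ w)
        called walked = call walkRegisters walked refl refl

        prepared : Runs prepareProg (encode C ∷ π₁ ∷ π₂ ∷ Vec.replicate 15 [])
          (all (code N) (trues n) (trues (n + n)) (false ∷ false ∷ []) (true ∷ []) π₁ [] (true ∷ []) π₂ [] [])
        prepared =
          call (0F ∷ 4F ∷ []) (unary-runs n (≤-trans (n≤1+n n) 1+n≤)) refl refl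
          ⟫ call (0F ∷ 5F ∷ [])
              (unary-runs (2 * n) (≤-trans (≤-reflexive (cong (n +_) (+-identityʳ n))) (≤-trans (m≤n+m _ 2) 2n≤))) refl
              (cong (λ k → all (code N) (trues n) (trues (n + k)) [] [] [] [] [] [] [] []) (+-identityʳ n))
          ⟫ call (1F ∷ 14F ∷ 8F ∷ []) (copyLong-runs N₁) refl refl
          ⟫ call (2F ∷ 14F ∷ 11F ∷ []) (copyLong-runs N₂) refl refl
          -- The stack 00 is `leaf []`, the path of the root. `true ∷ []` is `str (partial [])`:
          -- both players start from an unfinished root, as `root-not-done` justifies.
          ⟫ runs refl

outcome-runs : ∀ {k} (c : Prog (4 + k)) x a b {σ y} →
               Library.Runs (length x) c (x ∷ a ∷ b ∷ Vec.replicate (suc k) []) σ → lookup σ 3F ≡ y →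
               outcome c (x ∷ a ∷ b ∷ []) ≡ y
outcome-runs c x a b (Library.runs refl) e = e

-- Abstract, so that equality checks do not unfold the verifier.
abstract
  verdictOn : Vec BitString 3 → BitString
  verdictOn = outcome verifier

  verdictOn-polyTime : PolyTime verdictOn
  verdictOn-polyTime = outcome-polyTime verifier

  verdictOn-runs : ∀ x a b {σ y} → Library.Runs (length x) verifier (x ∷ a ∷ b ∷ Vec.replicate 15 []) σ →
                   lookup σ 3F ≡ y → verdictOn (x ∷ a ∷ b ∷ []) ≡ y
  verdictOn-runs = outcome-runs verifier

-- The algorithm and its output

algorithm : FS₂P-Algorithm
algorithm = record
  -- This is the square. A history has `2n + 1` blocks of `2n + 2` bits, and both numbers are at
  -- most the input length, as the input spells out `n` and `2n` in unary.
  { ℓ          = 0 ∷ 0 ∷ 1 ∷ []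
  ; V          = verdictOn
  ; V-polyTime = verdictOn-polyTime
  }

square : ∀ N → ⟦ 0 ∷ 0 ∷ 1 ∷ [] ⟧ N ≡ N * N
square N = cong (N *_) (trans (cong (λ z → N * (1 + z)) (*-zeroʳ N)) (*-identityʳ N))

pad : ∀ (xs : BitString) {m} → length xs ≤ m → ∃[ v ] ∃[ ys ] toList {n = m} v ≡ xs ++ ys
pad []       {m} _ = Vec.replicate m false , _ , refl
pad (x ∷ xs) (s≤s h) with pad xs h
... | v , ys , e = x ∷ v , ys , cong (x ∷_) e

module Parsing {n : ℕ} (C : Circuit n (2 * n)) where
  open Halves C

  parseBlock : ∀ q → length q ≡ 2 + (n + n) → ∃[ B ] encB B ≡ q
  parseBlock q e with q ʳ++ [] in eq | trans (ʳ++-[]-length q) e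
  ... | l ∷ k ∷ q′ | e′ with split-list n q′ (suc-injective (suc-injective e′))
  ...   | a , q″ , refl , e″ with split-list n q″ (trans e″ (sym (+-identityʳ n)))
  ...     | b , [] , refl , _ = block k l a b ,
    trans (cong (λ w → (toList a ++ w) ʳ++ k ∷ l ∷ []) (sym (++-identityʳ (toList b))))
          (trans (cong (_ʳ++ []) (sym eq)) (unreverse-[] q))

  -- Every string of the right length encodes a block, so each proof of the opponent is a history
  -- and none has to be rejected as malformed.
  parseBlocks : ∀ j zs → j * (2 + (n + n)) ≤ length zs → ∃[ h ] ∃[ rs ] length h ≡ j × encodeBlocks h ++ rs ≡ zs
  parseBlocks zero    zs _  = [] , zs , refl , refl
  parseBlocks (suc j) zs le with split-list (2 + (n + n)) zs {length zs ∸ (2 + (n + n))} (sym (m+[n∸m]≡n (m+n≤o⇒m≤o (2 + (n + n)) le)))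
  ... | v , q , refl , lq with parseBlock (toList v) (Vecₚ.length-toList v)
  ...   | B , eB with parseBlocks j q (subst (j * (2 + (n + n)) ≤_) (sym lq)
                        (≤-trans (≤-reflexive (sym (m+n∸m≡n (2 + (n + n)) _))) (∸-monoˡ-≤ (2 + (n + n)) le)))
  ...     | h , rs , lh , e = B ∷ h , rs , cong suc lh ,
    trans (++-assoc (encB B) (encodeBlocks h) rs) (cong₂ _++_ eB e)

  length-encodeBlocks : ∀ h → length (encodeBlocks h) ≡ length h * (2 + (n + n))
  length-encodeBlocks []      = refl
  length-encodeBlocks (B ∷ h) = trans (length-++ (encB B)) (cong₂ _+_ (length-encB B) (length-encodeBlocks h))

module _ {m : ℕ} (C : Circuit (suc m) (2 * suc m)) where
  open Halves C
  open Parsing C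
  open Circuit C

  private
    n N : ℕ
    n = suc m
    N = length (encode C)

    gatesAndOutputs : BitString
    gatesAndOutputs = code N

    length-unary : ∀ k rest → length (unary k ++ rest) ≡ suc k + length rest
    length-unary zero    rest = refl
    length-unary (suc k) rest = cong suc (length-unary k rest)

    N≡ : N ≡ suc n + (suc (2 * n) + length gatesAndOutputs)
    N≡ = trans (length-unary n _) (cong (suc n +_) (length-unary (2 * n) _))

    code≤ : length (code N) ≤ N
    code≤ = subst (length gatesAndOutputs ≤_) (sym N≡) (≤-trans (m≤n+m _ (suc (2 * n))) (m≤n+m _ (suc n)))

    wires≤ : wires ≤ N
    wires≤ = begin
      wires                                                 ≡⟨ sym (#gates-wires gates) ⟩
      #gates gates + n                                      ≡⟨ +-comm (#gates gates) n ⟩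
      n + #gates gates                                      ≤⟨ +-mono-≤ (n≤1+n n) (≤-trans (≤-trans (m≤n+m _ 2) (m≤m+n _ _)) (≤-trans (#gates-encode gates _) (m≤n+m _ (suc (2 * n))))) ⟩
      suc n + (suc (2 * n) + length gatesAndOutputs)        ≡⟨ sym N≡ ⟩
      N                                                     ∎
      where open ≤-Reasoning

    2n≤ : 2 + (n + n) ≤ N
    2n≤ = begin
      2 + (n + n)                                     ≡⟨ cong (2 +_) (cong (n +_) (sym (+-identityʳ n))) ⟩
      1 + suc (2 * n)                                 ≤⟨ +-mono-≤ (s≤s {n = n} z≤n) (m≤m+n (suc (2 * n)) (length gatesAndOutputs)) ⟩
      suc n + (suc (2 * n) + length gatesAndOutputs)  ≡⟨ sym N≡ ⟩
      N                                               ∎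
      where open ≤-Reasoning

    blocks≤ : suc (n + n) * (2 + (n + n)) ≤ N * N
    blocks≤ = *-mono-≤ (≤-trans (n≤1+n _) 2n≤) 2n≤

    Proofs : Set
    Proofs = FS₂P-Algorithm.Proof algorithm (encode C)

    length-proof : ∀ (π : Proofs) → length (toList π) ≡ N * N
    length-proof π = trans (Vecₚ.length-toList π) (square N)

    parse : ∀ (π : Proofs) → ∃[ h ] ∃[ rs ] length h ≡ suc (n + n) × encodeBlocks h ++ rs ≡ toList π
    parse π = parseBlocks (suc (n + n)) (toList π) (subst (suc (n + n) * (2 + (n + n)) ≤_) (sym (length-proof π)) blocks≤)

    verify-value : ∀ (π₁ π₂ : Proofs) h₁ h₂ {rs₁ rs₂ y} → length h₁ ≡ suc (n + n) → length h₂ ≡ suc (n + n) →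
      encodeBlocks h₁ ++ rs₁ ≡ toList π₁ → encodeBlocks h₂ ++ rs₂ ≡ toList π₂ →
      extract (onTop (Correct.verdict C N code≤ wires≤ 2n≤ h₁ h₂) h₁ h₂ h₁) ≡ just y →
      FS₂P-Algorithm.verify algorithm (encode C) π₁ π₂ ≡ y
    verify-value π₁ π₂ h₁ h₂ {rs₁} {rs₂} {y} l₁ l₂ e₁ e₂ ext =
      let σ , ran , y≡ = Correct.verifier-runs C N code≤ wires≤ 2n≤ h₁ rs₁ h₂ rs₂ y l₁ l₂ (fits π₁ e₁) (fits π₂ e₂) ext
      in trans (cong₂ (λ u v → verdictOn (encode C ∷ u ∷ v ∷ [])) (sym e₁) (sym e₂))
               (verdictOn-runs (encode C) (encodeBlocks h₁ ++ rs₁) (encodeBlocks h₂ ++ rs₂) ran y≡)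
      where
      fits : ∀ π {w} → w ≡ toList π → length w ≤ N * N
      fits π refl = ≤-reflexive (length-proof π)

    module Winning (h : List Block) (lh : length h ≡ suc (n + n)) (o : Partial (n + n) [] h)
                   (π : Proofs) {rs : BitString} (eπ : encodeBlocks h ++ rs ≡ toList π)
                   {y : BitString} (ext : extract h ≡ just y) where

      first : ∀ π₂ → FS₂P-Algorithm.verify algorithm (encode C) π π₂ ≡ y
      first π₂ =
        let h₂ , rs₂ , l₂ , e₂ = parse π₂
        in verify-value π π₂ h h₂ lh l₂ eπ e₂ (chosen h₂ (partial-wins (n + n) h [] (partial []) h₂ [] o))
        where
        chosen : ∀ h₂ {W} → Concedes W (partial []) h₂ h → extract (onTop W h h₂ h) ≡ just y
        chosen _ (inj₁ (_ , refl))          = ext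
        chosen _ {[]}        (inj₂ _)       = ext
        chosen _ {false ∷ _} (inj₂ (_ , e)) = trans e ext
        chosen _ {true ∷ _}  (inj₂ _)       = ext

      second : ∀ π₁ → FS₂P-Algorithm.verify algorithm (encode C) π₁ π ≡ y
      second π₁ =
        let h₁ , rs₁ , l₁ , e₁ = parse π₁
        in verify-value π₁ π h₁ h l₁ lh e₁ eπ
             -- From the correct player's side the verdicts are the negated ones, so `partial-wins`
             -- applies with the players exchanged.
             (chosen h₁ (subst (λ W → Concedes W (partial []) h₁ h)
                               (walk-swap (n + n) [] (partial []) h₁ (partial []) h [])
                               (partial-wins (n + n) h [] (partial []) h₁ [] o)))
        where
        chosen : ∀ h₁ {W} → Concedes (map not W) (partial []) h₁ h → extract (onTop W h₁ h h₁) ≡ just y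
        chosen _ {[]}        (inj₂ (_ , e)) = trans e ext
        chosen _ {false ∷ _} _              = ext
        chosen _ {true ∷ _}  (inj₂ (_ , e)) = trans e ext

    missed-output : ∀ a b → Missed a b → ∃[ y ] toList a ++ toList b ≡ toList y × ¬ (y ∈Im C)
    missed-output a b missed = y , toList-y , avoided
      where
      y : Vec Bool (2 * n)
      y = a Vec.++ Vec.cast (sym (+-identityʳ n)) b
      toList-y : toList a ++ toList b ≡ toList y
      toList-y = sym (trans (Vecₚ.toList-++ a _) (cong (toList a ++_) (Vecₚ.toList-cast (sym (+-identityʳ n)) b)))
      avoided : ¬ (y ∈Im C)
      avoided (x , e) = missed x (cong₂ _,_ (proj₁ parts) (toList-injective _ _ (proj₂ parts)))
        where
        parts : proj₁ (halves x) ≡ a × toList (proj₂ (halves x)) ≡ toList b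
        parts = toList-++-injective _ a (trans (toList-halves x) (trans (cong toList e) (sym toList-y)))

  outputs-missed : ∃[ y ] FS₂P-Algorithm.Outputs algorithm (encode C) (toList y) × ¬ (y ∈Im C)
  outputs-missed =
    let h , lh , o              = history halves
        a , b , ext , missed    = partial-missed (n + n) o
        y , toList-y , avoided  = missed-output a b missed
        π , rs , eπ             = pad (encodeBlocks h)
          (≤-trans (≤-reflexive (trans (length-encodeBlocks h) (cong (_* (2 + (n + n))) lh)))
                   (≤-trans blocks≤ (≤-reflexive (sym (square N)))))
        open Winning h lh o π (sym eπ) (trans ext (cong just toList-y))
    in y , ((π , first) , (π , second)) , avoided

mainTheorem13 : Σ FS₂P-Algorithm λ A →
    ∀ (n : ℕ) .{{_ : NonZero n}} (C : Circuit n (2 * n)) →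
    ∃[ y ] FS₂P-Algorithm.Outputs A (encode C) (toList y) × ¬ (y ∈Im C)
mainTheorem13 = algorithm , λ { (suc m) C → outputs-missed C }
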